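{- Let $p$ be an odd prime, $n$ a positive integer, $q=p^n$ (so $q^2=p^{2n}$), and let $k$ be an integer with $1\le k\le n$ such that $2n/\gcd(2n,k)$ is odd. Let $f$ be either $f(x)=x^2$ or $f(x)=x^{p^k+1}$ on $\mathbb F_{q^2}$, and let $\theta\in\mathbb F_{q^2}^*$ be such that $\theta^{q+1}$ is a nonsquare in $\mathbb F_q$. Then the unital $\mathcal U_\theta:=\{(x,t\theta):x\in\mathbb F_{q^2},t\in\mathbb F_q\}\cup\{(\infty)\}$ in $\Pi(f)$ contains an O'Nan configuration.
   Context: For a planar function $f$ on $\mathbb F_{q^2}$ (i.e.\ $x\mapsto f(x+a)-f(x)$ is bijective for each $a\neq0$; both functions above are planar), $\Pi(f)$ is the projective plane with points $(x,y)\in\mathbb F_{q^2}^2$ and $(a)$ for $a\in\mathbb F_{q^2}\cup\{\infty\}$, lines $L_{a,b}=\{(x,f(x+a)-b):x\in\mathbb F_{q^2}\}\cup\{(a)\}$, $N_a=\{(a,y):y\in\mathbb F_{q^2}\}\cup\{(\infty)\}$ ($a,b\in\mathbb F_{q^2}$), $L_\infty=\{(a):a\in\mathbb F_{q^2}\cup\{\infty\}\}$. A unital is a set of $q^3+1$ points meeting every line in $1$ or $q+1$ points, regarded as a design whose blocks are its intersections with lines meeting it in $q+1$ points. An O'Nan configuration consists of four blocks, any two of which meet, such that the six pairwise intersection points are distinct. -}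

module Defs where

open import Level using (Level; _⊔_)
open import Algebra.Bundles using (CommutativeRing)
open import Data.Fin using (Fin; _<_)
open import Data.Maybe using (Maybe; just; nothing)
open import Data.Maybe.Relation.Binary.Pointwise as Maybeₛ using ()
open import Data.Nat as ℕ using (ℕ)
import Data.Nat.Divisibility as ℕ
open import Data.Nat.GCD using (gcd; gcd[m,n]∣m)
open import Data.Product using (Σ; ∃; ∃-syntax; _×_; _,_; proj₁)
open import Data.Product.Relation.Binary.Pointwise.NonDependent using (_×ₛ_)
open import Data.Sum using (_⊎_; inj₁; inj₂)
open import Data.Sum.Relation.Binary.Pointwise using (_⊎ₛ_)
open import Function.Bundles using (Inverse)
open import Relation.Binary.Bundles using (Setoid)
open import Relation.Binary.Definitions using (_Respects_)
import Relation.Binary.Construct.On as On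
open import Relation.Binary.PropositionalEquality as ≡ using (_≡_; _≢_)
open import Relation.Nullary using (¬_)
open import Relation.Unary using (Pred; _∩_; _≐_)

private variable
  a b c ℓ κ υ : Level

Odd : ℕ → Set
Odd m = ¬ (2 ℕ.∣ m)

-- The exact quotient m / gcd(m,n), read off the proof that gcd m n divides m.
_/gcd_ : ℕ → ℕ → ℕ
m /gcd n = ℕ.quotient (gcd[m,n]∣m m n)

HasOrder : Setoid a b → ℕ → Set (a ⊔ b)
HasOrder S m = Inverse (≡.setoid (Fin m)) S

-- Elements of a subset are identified when their underlying elements are
-- equal, so HasSize does not count membership proofs.
HasSize : (S : Setoid a b) → Pred (Setoid.Carrier S) κ → ℕ → Set (a ⊔ b ⊔ κ)
HasSize S P m = HasOrder (On.setoid {B = ∃ P} S proj₁) m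

module _ (F : CommutativeRing c ℓ) where
  open CommutativeRing F
  open import Algebra.Definitions _≈_ using (Invertible)
  open import Algebra.Properties.Semiring.Exp semiring using (_^_)

  record IsField : Set (c ⊔ ℓ) where
    field
      1≉0        : ¬ (1# ≈ 0#)
      invertible : ∀ x → ¬ (x ≈ 0#) → Invertible 1# _*_ x

  record IsSubfield (K : Pred Carrier κ) : Set (c ⊔ ℓ ⊔ κ) where
    field
      resp      : K Respects _≈_
      0∈        : K 0#
      1∈        : K 1#
      +-closed  : ∀ {x y} → K x → K y → K (x + y)
      -‿closed  : ∀ {x} → K x → K (- x)
      *-closed  : ∀ {x y} → K x → K y → K (x * y)
      ⁻¹-closed : ∀ {x y} → K x → x * y ≈ 1# → K y

  IsSquareIn : Pred Carrier κ → Pred Carrier (c ⊔ ℓ ⊔ κ)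
  IsSquareIn K x = ∃[ s ] (K s × s ^ 2 ≈ x)

  pointSetoid : Setoid c (c ⊔ ℓ)
  pointSetoid = (setoid ×ₛ setoid) ⊎ₛ Maybeₛ.setoid setoid

  open Setoid pointSetoid public
    using () renaming (Carrier to Point; _≈_ to _≈ᵖ_)

  pattern aff x y = inj₁ (x , y)
  pattern dir s   = inj₂ (just s)
  pattern ∞       = inj₂ nothing

  data Line : Set c where
    L  : Carrier → Carrier → Line
    N  : Carrier → Line
    L∞ : Line

  -- The point set of a line of Π(f).
  pointsOn : (Carrier → Carrier) → Line → Pred Point (c ⊔ ℓ)
  pointsOn f (L s b) P = (∃[ x ] P ≈ᵖ aff x (f (x + s) - b)) ⊎ P ≈ᵖ dir s
  pointsOn f (N s)   P = (∃[ y ] P ≈ᵖ aff s y) ⊎ P ≈ᵖ ∞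
  pointsOn f L∞      P = (∃[ s ] P ≈ᵖ dir s) ⊎ P ≈ᵖ ∞

  -- K plays the role of the subfield 𝔽_q.
  𝒰 : Pred Carrier κ → Carrier → Pred Point (c ⊔ ℓ ⊔ κ)
  𝒰 K θ P = (∃[ x ] ∃[ t ] (K t × P ≈ᵖ aff x (t * θ))) ⊎ P ≈ᵖ ∞

  -- The section by l of a unital U of order q in Π(f) is a block of its design
  -- exactly when it has q + 1 points.
  section : (Carrier → Carrier) → Pred Point υ → Line → Pred Point (c ⊔ ℓ ⊔ υ)
  section f U l = U ∩ pointsOn f l

  IsBlock : (Carrier → Carrier) → Pred Point υ → ℕ → Line → Set (c ⊔ ℓ ⊔ υ)
  IsBlock f U q l = HasSize pointSetoid (section f U l) (q ℕ.+ 1)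

  -- The pairwise intersection points are meet i j for i < j; other values of
  -- meet are irrelevant.  Distinctness of blocks is as sets of points.
  record ONanConfiguration (f : Carrier → Carrier) (U : Pred Point υ) (q : ℕ)
         : Set (c ⊔ ℓ ⊔ υ) where
    field
      line          : Fin 4 → Line
      isBlock       : ∀ i → IsBlock f U q (line i)
      blockDistinct : ∀ i j → i ≢ j →
                      ¬ (section f U (line i) ≐ section f U (line j))
      meet          : Fin 4 → Fin 4 → Point
      meet∈         : ∀ i j → i < j →
                      (section f U (line i) ∩ section f U (line j)) (meet i j)
      meetDistinct  : ∀ i j k l → i < j → k < l →
                      meet i j ≈ᵖ meet k l → i ≡ k × j ≡ l

{-# OPTIONS --safe #-}
module Submission where

-- Both functions have the form f(x) = x φ(x) for an endomorphism φ of F (the identity or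
-- x ↦ x^(p^k)) with φ²ʲ⁺¹ = id.  The alternating product s(u) = u φ(u)⁻¹ φ²(u) ⋯ φ²ʲ(u)
-- satisfies f(s(u)) = u² and is a bijection of F, so a section of the unital by L_{s,b}
-- corresponds to a conic { u | u² - d² ∈ Kθ }.  As θ is a nonsquare of F this conic has no
-- points at infinity, and projecting from d shows that it has q + 1 points.
--
-- Splitting off φ-conjugates of θ gives θ = h φ(h) θ₀ with φ(θ₀) = θ₀.  On the points hX with
-- φ(X) = X the function f is the quadratic map X ↦ h φ(h) X², and there the four lines
-- L_{hg, h φ(h) g² - yθ} with (g, y) = (∓(1 + θ₀), 8), (±(1 - θ₀), 0) meet in the six points
-- (0, 8θ), (0, 0), (±2hθ₀, 4θ), (±2h, 4θ).

open import Defs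
open import Algebra.Bundles using (CommutativeMonoid; CommutativeRing)
open import Algebra.Morphism.Structures using (module RingMorphisms)
import Algebra.Properties.AbelianGroup
import Algebra.Properties.CommutativeMonoid.Sum as CommutativeMonoidSum
import Algebra.Properties.CommutativeSemiring.Binomial as Binomial
import Algebra.Properties.CommutativeSemiring.Exp as CommutativeExp
import Algebra.Properties.Ring
import Algebra.Properties.Semiring.Exp as Exp
import Algebra.Properties.Semiring.Mult
import Algebra.Properties.Semiring.Mult.TCOptimised
import Algebra.Solver.Ring
open import Algebra.Solver.Ring.AlmostCommutativeRing using (fromCommutativeRing; _-Raw-AlmostCommutative⟶_)
open import Data.Fin as Fin using (Fin; zero; suc; _<_; _<?_)
open import Data.Fin.Patterns using (0F; 1F; 2F; 3F; 4F; 5F)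
open import Data.Fin.Permutation using (Permutation′; _⟨$⟩ʳ_)
import Data.Fin.Properties as Fin
open import Data.Integer.Base as ℤ using (ℤ; +_; -[1+_]; _⊖_; _◃_; sign; ∣_∣)
import Data.Integer.Properties as ℤ
open import Data.Maybe using (Maybe; just; nothing)
open import Data.Nat as ℕ using (ℕ; zero; suc; _!; z<s; s<s)
open import Data.Nat.Combinatorics using (_C_; nCn≡1; nCk≡n!/k![n-k]!; k![n∸k]!∣n!)
import Data.Nat.Divisibility as ℕ
import Data.Nat.DivMod as ℕ
open import Data.Nat.GCD using (gcd; gcd[m,n]∣m; gcd[m,n]∣n)
open import Data.Nat.GeneralisedArithmetic using (fold)
open import Data.Nat.Primality using (Prime; euclidsLemma; prime⇒nonTrivial)
import Data.Nat.Properties as ℕ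
open import Data.Product using (∃; ∃-syntax; _×_; _,_; proj₁; proj₂)
open import Data.Sign.Base as Sign using (Sign)
open import Data.Sum using (_⊎_; inj₁; inj₂; [_,_]′)
open import Data.Sum.Relation.Binary.Pointwise using (inj₁; inj₂)
open import Data.Unit using (⊤; tt)
open import Data.Vec as Vec using (Vec; []; _∷_)
open import Function using (_∘_; id)
open import Function.Bundles using (Inverse)
import Function.Construct.Composition as Composition
import Function.Construct.Symmetry as Symmetry
open import Level using (Level; _⊔_)
open import Relation.Binary.Bundles using (Setoid)
import Relation.Binary.Construct.On as On
open import Relation.Binary.Definitions using (Decidable; Symmetric; tri<; tri≈; tri>)
open import Relation.Binary.PropositionalEquality as ≡ using (_≡_; _≢_)
import Relation.Binary.Reasoning.Setoid as SetoidReasoning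
open import Relation.Nullary using (¬_; Dec; yes; no; contradiction)
open import Relation.Nullary.Decidable using (map′; _×-dec_; _→-dec_; from-yes)
open import Relation.Unary using (Pred; _≐_)

-- The substitution by s is in general not additive: it yields the size of a single section but says
-- little about how two sections meet. Incidences therefore use a second linearisation x = hX, in
-- which X has to be fixed by φ; the reduction of θ to a fixed θ₀ makes abscissas such as 2θ₀
-- admissible there. Odd order of φ is what makes s work: s(u) φ(s(u)) telescopes to u times
-- φ²ʲ⁺¹(u) = u, whereas an even number of factors would collapse to 1. It is also a source of s(-u)
-- = -s(u), hence of injectivity. The constants come from Vieta. At t = 4 the four line equations
-- are (X ∓ 2)(X ∓ 2θ₀) = 0, one for each choice of signs. Two products with a common factor share
-- its root; two without one are exchanged by X ↦ -X and so meet at X = 0. The remaining danger is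
-- θ₀ = ±1, which is excluded because hφ(h) is a square while ±θ is not.

private variable
  a b c ℓ κ : Level

-- Ring identities with integer coefficients

-- The standard solver with integer coefficients: an abstract ring used as its
-- own coefficient ring could not detect cancellations.
module IntegerCoefficients (R : CommutativeRing c ℓ) where
  open CommutativeRing R
  open Algebra.Properties.Ring ring using (-‿distribˡ-*; -‿distribʳ-*)
  open Algebra.Properties.AbelianGroup +-abelianGroup using ()
    renaming (⁻¹-∙-comm to -‿+-comm; ⁻¹-involutive to -‿involutive; ε⁻¹≈ε to -0≈0)
  open Algebra.Properties.Semiring.Mult.TCOptimised semiring renaming (_×_ to _·_)
  module Unoptimised = Algebra.Properties.Semiring.Mult semiring
  open SetoidReasoning setoid

  -- With these multiples `⟦ + 1 ⟧` and `⟦ + 2 ⟧` reduce to `1#` and `1# + 1#`, so numerals in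
  -- solver equations match the terms of the goals.
  ⟦_⟧ : ℤ → Carrier
  ⟦ + n ⟧      = n · 1#
  ⟦ -[1+ n ] ⟧ = - (suc n · 1#)

  ×1-*-homo : ∀ m n → (m ℕ.* n) · 1# ≈ m · 1# * n · 1#
  ×1-*-homo m n = begin
    (m ℕ.* n) · 1#                            ≈⟨ ×ᵤ≈× (m ℕ.* n) 1# ⟨
    (m ℕ.* n) Unoptimised.× 1#                ≈⟨ Unoptimised.idem-×-homo-* m n (*-identityˡ 1#) ⟨
    m Unoptimised.× 1# * n Unoptimised.× 1#   ≈⟨ *-cong (×ᵤ≈× m 1#) (×ᵤ≈× n 1#) ⟩
    m · 1# * n · 1#                           ∎

  ⊖-homo : ∀ m n → ⟦ m ⊖ n ⟧ ≈ m · 1# + - (n · 1#)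
  ⊖-homo m       zero    = sym (trans (+-congˡ -0≈0) (+-identityʳ _))
  ⊖-homo zero    (suc n) = sym (+-identityˡ _)
  ⊖-homo (suc m) (suc n) = begin
    ⟦ suc m ⊖ suc n ⟧                             ≡⟨ ≡.cong ⟦_⟧ (ℤ.[1+m]⊖[1+n]≡m⊖n m n) ⟩
    ⟦ m ⊖ n ⟧                                     ≈⟨ ⊖-homo m n ⟩
    m · 1# + - (n · 1#)                           ≈⟨ +-congʳ (+-identityʳ _) ⟨
    m · 1# + 0# + - (n · 1#)                      ≈⟨ +-congʳ (+-congˡ (-‿inverseʳ 1#)) ⟨
    m · 1# + (1# + - 1#) + - (n · 1#)             ≈⟨ +-congʳ (+-assoc _ _ _) ⟨
    m · 1# + 1# + - 1# + - (n · 1#)               ≈⟨ +-assoc _ _ _ ⟩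
    m · 1# + 1# + (- 1# + - (n · 1#))             ≈⟨ +-cong (+-comm _ _) (-‿+-comm _ _) ⟩
    1# + m · 1# + - (1# + n · 1#)                 ≈⟨ +-cong (1+× m 1#) (-‿cong (1+× n 1#)) ⟨
    suc m · 1# + - (suc n · 1#)                   ∎

  +-homo : ∀ i j → ⟦ i ℤ.+ j ⟧ ≈ ⟦ i ⟧ + ⟦ j ⟧
  +-homo (+ m)      (+ n)      = ×-homo-+ 1# m n
  +-homo (+ m)      -[1+ n ]   = ⊖-homo m (suc n)
  +-homo -[1+ m ]   (+ n)      = trans (⊖-homo n (suc m)) (+-comm _ _)
  +-homo -[1+ m ]   -[1+ n ]   = begin
    - (suc (suc (m ℕ.+ n)) · 1#)        ≡⟨ ≡.cong (λ k → - (k · 1#)) (ℕ.+-suc (suc m) n) ⟨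
    - ((suc m ℕ.+ suc n) · 1#)          ≈⟨ -‿cong (×-homo-+ 1# (suc m) (suc n)) ⟩
    - (suc m · 1# + suc n · 1#)         ≈⟨ -‿+-comm _ _ ⟨
    - (suc m · 1#) + - (suc n · 1#)     ∎

  signed : Sign → Carrier → Carrier
  signed Sign.+ x = x
  signed Sign.- x = - x

  ◃-homo : ∀ s n → ⟦ s ◃ n ⟧ ≈ signed s (n · 1#)
  ◃-homo Sign.+ zero    = refl
  ◃-homo Sign.- zero    = sym -0≈0
  ◃-homo Sign.+ (suc n) = refl
  ◃-homo Sign.- (suc n) = refl

  signed-* : ∀ s t x y → signed (s Sign.* t) (x * y) ≈ signed s x * signed t y
  signed-* Sign.+ Sign.+ x y = refl
  signed-* Sign.+ Sign.- x y = -‿distribʳ-* x y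
  signed-* Sign.- Sign.+ x y = -‿distribˡ-* x y
  signed-* Sign.- Sign.- x y = begin
    x * y          ≈⟨ -‿involutive _ ⟨
    - (- (x * y))  ≈⟨ -‿cong (-‿distribʳ-* x y) ⟩
    - (x * - y)    ≈⟨ -‿distribˡ-* x (- y) ⟩
    - x * - y      ∎

  signed-cong : ∀ s {x y} → x ≈ y → signed s x ≈ signed s y
  signed-cong Sign.+ eq = eq
  signed-cong Sign.- eq = -‿cong eq

  ⟦⟧-signed : ∀ i → ⟦ i ⟧ ≈ signed (sign i) (∣ i ∣ · 1#)
  ⟦⟧-signed (+ n)      = refl
  ⟦⟧-signed -[1+ n ]   = refl

  *-homo : ∀ i j → ⟦ i ℤ.* j ⟧ ≈ ⟦ i ⟧ * ⟦ j ⟧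
  *-homo i j = begin
    ⟦ i ℤ.* j ⟧
      ≈⟨ ◃-homo (sign i Sign.* sign j) (∣ i ∣ ℕ.* ∣ j ∣) ⟩
    signed (sign i Sign.* sign j) ((∣ i ∣ ℕ.* ∣ j ∣) · 1#)
      ≈⟨ signed-cong (sign i Sign.* sign j) (×1-*-homo ∣ i ∣ ∣ j ∣) ⟩
    signed (sign i Sign.* sign j) (∣ i ∣ · 1# * ∣ j ∣ · 1#)        ≈⟨ signed-* (sign i) (sign j) _ _ ⟩
    signed (sign i) (∣ i ∣ · 1#) * signed (sign j) (∣ j ∣ · 1#)    ≈⟨ *-cong (⟦⟧-signed i) (⟦⟧-signed j) ⟨
    ⟦ i ⟧ * ⟦ j ⟧                                                  ∎

  -‿homo : ∀ i → ⟦ ℤ.- i ⟧ ≈ - ⟦ i ⟧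
  -‿homo (+ zero)    = sym -0≈0
  -‿homo (+ (suc n)) = refl
  -‿homo -[1+ n ]    = sym (-‿involutive _)

  morphism : ℤ.+-*-rawRing -Raw-AlmostCommutative⟶ fromCommutativeRing R
  morphism = record
    { ⟦_⟧    = ⟦_⟧
    ; +-homo = +-homo
    ; *-homo = *-homo
    ; -‿homo = -‿homo
    ; 0-homo = refl
    ; 1-homo = refl
    }

  coefficient≟ : ∀ i j → Maybe (⟦ i ⟧ ≈ ⟦ j ⟧)
  coefficient≟ i j with i ℤ.≟ j
  ... | yes ≡.refl = just refl
  ... | no _       = nothing

  open Algebra.Solver.Ring ℤ.+-*-rawRing (fromCommutativeRing R) morphism coefficient≟ public
    using (Polynomial; solve; _:+_; _:*_; _:-_; :-_; _:=_; con)

-- Finite setoids and fields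

-- Pigeonhole: punching a missed `y` out of the codomain would leave an injection of `Fin (suc m)`
-- into `Fin m`.
Fin-injective⇒surjective : ∀ {m} {g : Fin m → Fin m} → (∀ {i j} → g i ≡ g j → i ≡ j) → ∀ y → ∃[ i ] g i ≡ y
Fin-injective⇒surjective {suc m} {g} injective y with Fin.any? (λ i → g i Fin.≟ y)
... | yes y∈image = y∈image
... | no  y∉image = contradiction
  (Fin.injective⇒≤ {f = λ i → Fin.punchOut (misses i)} (injective ∘ Fin.punchOut-injective (misses _) (misses _)))
  (ℕ.1+n≰n {m})
  where
  misses : ∀ i → y ≢ g i
  misses i y≡gi = y∉image (i , ≡.sym y≡gi)

module _ (S : Setoid a b) where
  open Setoid S

  enumeration⇒hasOrder : ∀ {m} (e : Fin m → Carrier) → (∀ {i j} → e i ≈ e j → i ≡ j) →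
                         (∀ x → ∃[ i ] e i ≈ x) → HasOrder S m
  enumeration⇒hasOrder e injective surjective = record
    { to        = e
    ; from      = proj₁ ∘ surjective
    ; to-cong   = λ { ≡.refl → refl }
    ; from-cong = λ {x} {y} x≈y → injective (trans (proj₂ (surjective x)) (trans x≈y (sym (proj₂ (surjective y)))))
    ; inverse   = (λ { ≡.refl → proj₂ (surjective _) })
                , (λ {i} {x} x≈ei → injective (trans (proj₂ (surjective x)) x≈ei))
    }

module FiniteSetoid {S : Setoid a b} {m : ℕ} (finite : HasOrder S m) where
  open Setoid S
  open Inverse finite public using () renaming (to to element; from to index)

  element-index : ∀ x → element (index x) ≈ x
  element-index = Inverse.strictlyInverseˡ finite

  index-element : ∀ i → index (element i) ≡ i
  index-element = Inverse.strictlyInverseʳ finite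

  index-injective : ∀ {x y} → index x ≡ index y → x ≈ y
  index-injective {x} {y} eq =
    trans (sym (element-index x)) (trans (Inverse.to-cong finite eq) (element-index y))

  element-injective : ∀ {i j} → element i ≈ element j → i ≡ j
  element-injective eᵢ≈eⱼ =
    ≡.trans (≡.sym (index-element _)) (≡.trans (Inverse.from-cong finite eᵢ≈eⱼ) (index-element _))

  _≟_ : Decidable _≈_
  x ≟ y = map′ index-injective (Inverse.from-cong finite) (index x Fin.≟ index y)

  injective⇒surjective : (g : Carrier → Carrier) → (∀ {x y} → x ≈ y → g x ≈ g y) →
                         (∀ {x y} → g x ≈ g y → x ≈ y) → ∀ y → ∃[ x ] g x ≈ y
  injective⇒surjective g cong injective y =
    let i , h[i]≡y = Fin-injective⇒surjective h-injective (index y) in element i , index-injective h[i]≡y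
    where
    h : Fin m → Fin m
    h = index ∘ g ∘ element
    h-injective : ∀ {i j} → h i ≡ h j → i ≡ j
    h-injective hi≡hj = element-injective (injective (index-injective hi≡hj))

  reindex : (g : Inverse S S) → Permutation′ m
  reindex g = Composition.inverse finite (Composition.inverse g (Symmetry.inverse finite))

module _ (M : CommutativeMonoid c ℓ) where
  open CommutativeMonoid M
  open CommutativeMonoidSum M using (sum; sum-remove; sum-cong-≋; sum-replicate-zero; sum-permute)

  sum-spike : ∀ {n} (t : Fin n → Carrier) i → (∀ j → j ≢ i → t j ≈ ε) → sum t ≈ t i
  sum-spike {suc n} t i vanishes =
    trans (sum-remove {i = i} t)
      (trans (∙-congˡ (trans (sum-cong-≋ (λ j → vanishes _ (Fin.punchInᵢ≢i i j))) (sum-replicate-zero n)))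
        (identityʳ (t i)))

  -- Used twice: with translation by `1#` in the additive monoid it bounds the characteristic, with
  -- dilations in the multiplicative monoid it gives Fermat's theorem.
  sum-reindex : {S : Setoid a b} {m : ℕ} (finite : HasOrder S m) (g : Inverse S S) (t : Setoid.Carrier S → Carrier) →
                (∀ {x y} → Setoid._≈_ S x y → t x ≈ t y) →
                sum (t ∘ Inverse.to finite) ≈ sum (t ∘ Inverse.to g ∘ Inverse.to finite)
  sum-reindex {m = m} finite g t cong =
    trans (sum-permute (t ∘ element) (reindex g))
      (sum-cong-≋ {m} {t ∘ element ∘ (reindex g ⟨$⟩ʳ_)} {t ∘ Inverse.to g ∘ element} (λ i → cong (element-index _)))
    where open FiniteSetoid finite

-- Fields with decidable equality, and roots of monic polynomials

module FieldProperties (F : CommutativeRing c ℓ) (isField : IsField F)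
                       (_≟_ : Decidable (CommutativeRing._≈_ F)) where
  open CommutativeRing F hiding (zero)
  open IsField isField
  open IntegerCoefficients F using (solve; _:+_; _:*_; _:-_; :-_; _:=_; con)
  open import Algebra.Properties.Group +-group public using () renaming (x∙y⁻¹≈ε⇒x≈y to x-y≈0⇒x≈y)
  open SetoidReasoning setoid

  x≈y⇒x-y≈0 : ∀ {x y} → x ≈ y → x - y ≈ 0#
  x≈y⇒x-y≈0 {x} {y} x≈y = trans (+-congʳ x≈y) (-‿inverseʳ y)

  x*y≈0⇒y≈0 : ∀ {x y} → x ≉ 0# → x * y ≈ 0# → y ≈ 0#
  x*y≈0⇒y≈0 {x} {y} x≉0 xy≈0 =
    let x⁻¹ , x⁻¹x≈1 , _ = invertible x x≉0 in begin
    y              ≈⟨ *-identityˡ y ⟨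
    1# * y         ≈⟨ *-congʳ x⁻¹x≈1 ⟨
    x⁻¹ * x * y    ≈⟨ *-assoc _ _ _ ⟩
    x⁻¹ * (x * y)  ≈⟨ *-congˡ xy≈0 ⟩
    x⁻¹ * 0#       ≈⟨ zeroʳ _ ⟩
    0#             ∎

  x*y≈0⇒x≈0 : ∀ {x y} → y ≉ 0# → x * y ≈ 0# → x ≈ 0#
  x*y≈0⇒x≈0 y≉0 xy≈0 = x*y≈0⇒y≈0 y≉0 (trans (*-comm _ _) xy≈0)

  x*y≈0⇒x≈0∨y≈0 : ∀ {x y} → x * y ≈ 0# → x ≈ 0# ⊎ y ≈ 0#
  x*y≈0⇒x≈0∨y≈0 {x} xy≈0 with x ≟ 0#
  ... | yes x≈0 = inj₁ x≈0
  ... | no  x≉0 = inj₂ (x*y≈0⇒y≈0 x≉0 xy≈0)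

  *-≉0 : ∀ {x y} → x ≉ 0# → y ≉ 0# → x * y ≉ 0#
  *-≉0 x≉0 y≉0 xy≈0 = y≉0 (x*y≈0⇒y≈0 x≉0 xy≈0)

  *-cancelˡ : ∀ {x y z} → x ≉ 0# → x * y ≈ x * z → y ≈ z
  *-cancelˡ {x} {y} {z} x≉0 xy≈xz = x-y≈0⇒x≈y y z (x*y≈0⇒y≈0 x≉0 (begin
    x * (y - z)    ≈⟨ solve 3 (λ x y z → x :* (y :- z) := x :* y :- x :* z) refl x y z ⟩
    x * y - x * z  ≈⟨ x≈y⇒x-y≈0 xy≈xz ⟩
    0#             ∎))

  *-cancelʳ : ∀ {x y z} → x ≉ 0# → y * x ≈ z * x → y ≈ z
  *-cancelʳ x≉0 yx≈zx = *-cancelˡ x≉0 (trans (*-comm _ _) (trans yx≈zx (*-comm _ _)))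

  -‿≉0 : ∀ {x} → x ≉ 0# → - x ≉ 0#
  -‿≉0 {x} x≉0 -x≈0 = x≉0 (begin
    x        ≈⟨ solve 1 (λ x → x := :- (:- x)) refl x ⟩
    - (- x)  ≈⟨ -‿cong -x≈0 ⟩
    - 0#     ≈⟨ solve 0 (:- con (+ 0) := con (+ 0)) refl ⟩
    0#       ∎)

  square-injective : ∀ {x y} → x * x ≈ y * y → x ≈ y ⊎ x ≈ - y
  square-injective {x} {y} x²≈y² with x*y≈0⇒x≈0∨y≈0 {x - y} {x + y}
    (trans (solve 2 (λ x y → (x :- y) :* (x :+ y) := x :* x :- y :* y) refl x y) (x≈y⇒x-y≈0 x²≈y²))
  ... | inj₁ x-y≈0 = inj₁ (x-y≈0⇒x≈y x y x-y≈0)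
  ... | inj₂ x+y≈0 = inj₂ (x-y≈0⇒x≈y x (- y)
    (trans (solve 2 (λ x y → x :- :- y := x :+ y) refl x y) x+y≈0))

  -- with 0⁻¹ = 0
  _⁻¹ : Carrier → Carrier
  x ⁻¹ with x ≟ 0#
  ... | yes _   = 0#
  ... | no  x≉0 = proj₁ (invertible x x≉0)

  ⁻¹-inverseʳ : ∀ {x} → x ≉ 0# → x * x ⁻¹ ≈ 1#
  ⁻¹-inverseʳ {x} x≉0 with x ≟ 0#
  ... | yes x≈0 = contradiction x≈0 x≉0
  ... | no  x≉0 = proj₂ (proj₂ (invertible x x≉0))

  ⁻¹-inverseˡ : ∀ {x} → x ≉ 0# → x ⁻¹ * x ≈ 1#
  ⁻¹-inverseˡ x≉0 = trans (*-comm _ _) (⁻¹-inverseʳ x≉0)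

  ⁻¹-unique : ∀ {x y} → x * y ≈ 1# → y ≈ x ⁻¹
  ⁻¹-unique {x} {y} xy≈1 = *-cancelˡ x≉0 (trans xy≈1 (sym (⁻¹-inverseʳ x≉0)))
    where
    x≉0 : x ≉ 0#
    x≉0 x≈0 = 1≉0 (trans (sym xy≈1) (trans (*-congʳ x≈0) (zeroˡ y)))

  0⁻¹≈0 : ∀ {x} → x ≈ 0# → x ⁻¹ ≈ 0#
  0⁻¹≈0 {x} x≈0 with x ≟ 0#
  ... | yes _   = refl
  ... | no  x≉0 = contradiction x≈0 x≉0

  ⁻¹-cong : ∀ {x y} → x ≈ y → x ⁻¹ ≈ y ⁻¹
  ⁻¹-cong {x} {y} x≈y with x ≟ 0#
  ... | yes x≈0 = sym (0⁻¹≈0 (trans (sym x≈y) x≈0))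
  ... | no  x≉0 = ⁻¹-unique (trans (*-congʳ (sym x≈y)) (proj₂ (proj₂ (invertible x x≉0))))

  ⁻¹-≉0 : ∀ {x} → x ≉ 0# → x ⁻¹ ≉ 0#
  ⁻¹-≉0 {x} x≉0 x⁻¹≈0 = 1≉0 (trans (sym (⁻¹-inverseʳ x≉0)) (trans (*-congˡ x⁻¹≈0) (zeroʳ x)))

  _^_ : Carrier → ℕ → Carrier
  _^_ = Exp._^_ semiring

  -- coefficients in increasing degree, with an implicit leading coefficient 1
  monic : ∀ {d} → Vec Carrier d → Carrier → Carrier
  monic []       x = 1#
  monic (c ∷ cs) x = c + x * monic cs x

  -- Synthetic division by X - r. The constant coefficient of the quotient is the tail evaluated at
  -- r, and the quotient is again monic, so the encoding is preserved.
  monic-factor : ∀ {d} (cs : Vec Carrier (suc d)) r →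
                 ∃[ ds ] ∀ x → monic cs x ≈ monic cs r + (x - r) * monic {d} ds x
  monic-factor (c ∷ []) r = [] , λ x →
    solve 3 (λ c x r → c :+ x :* con (+ 1) := c :+ r :* con (+ 1) :+ (x :- r) :* con (+ 1)) refl c x r
  monic-factor (c ∷ cs@(_ ∷ _)) r with monic-factor cs r
  ... | ds , factor = monic cs r ∷ ds , λ x → begin
    c + x * monic cs x                                 ≈⟨ +-congˡ (*-congˡ (factor x)) ⟩
    c + x * (monic cs r + (x - r) * monic ds x)        ≈⟨ solve 5 (λ c x r g h →
        c :+ x :* (g :+ (x :- r) :* h) := c :+ r :* g :+ (x :- r) :* (g :+ x :* h))
        refl c x r (monic cs r) (monic ds x) ⟩
    c + r * monic cs r + (x - r) * (monic cs r + x * monic ds x) ∎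

  -- The bound on the number of roots as a collision. Dividing out the first root leaves the others
  -- as roots of the quotient unless one of them repeats it; degree 0 is the constant 1, which has
  -- no root.
  monic-roots : ∀ {d} (cs : Vec Carrier d) (r : Fin (suc d) → Carrier) →
                (∀ i → monic cs (r i) ≈ 0#) → ∃[ i ] ∃[ j ] i ≢ j × r i ≈ r j
  monic-roots []          r root = contradiction (root zero) 1≉0
  monic-roots (cs@(_ ∷ _)) r root with monic-factor cs (r zero)
  ... | ds , factor with Fin.any? (λ i → r zero ≟ r (suc i))
  ... | yes (i , r₀≈rᵢ) = zero , suc i , (λ ()) , r₀≈rᵢ
  ... | no  r₀∉ with monic-roots ds (r ∘ suc) root′
    where
    root′ : ∀ i → monic ds (r (suc i)) ≈ 0#
    root′ i = x*y≈0⇒y≈0 (λ rᵢ-r₀≈0 → r₀∉ (i , sym (x-y≈0⇒x≈y _ _ rᵢ-r₀≈0))) (begin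
      (r (suc i) - r zero) * monic ds (r (suc i))                        ≈⟨ +-identityˡ _ ⟨
      0# + (r (suc i) - r zero) * monic ds (r (suc i))                   ≈⟨ +-congʳ (root zero) ⟨
      monic cs (r zero) + (r (suc i) - r zero) * monic ds (r (suc i))    ≈⟨ factor (r (suc i)) ⟨
      monic cs (r (suc i))                                               ≈⟨ root (suc i) ⟩
      0#                                                                 ∎)
  ... | i , j , i≢j , rᵢ≈rⱼ = suc i , suc j , i≢j ∘ Fin.suc-injective , rᵢ≈rⱼ

  -- the coefficients of X^(d+2) - X
  fermatPolynomial : ∀ d → Vec Carrier (2 ℕ.+ d)
  fermatPolynomial d = 0# ∷ - 1# ∷ Vec.replicate d 0#

  monic-replicate-0 : ∀ d x → monic (Vec.replicate d 0#) x ≈ x ^ d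
  monic-replicate-0 zero    x = refl
  monic-replicate-0 (suc d) x = trans (+-identityˡ _) (*-congˡ (monic-replicate-0 d x))

  fermatPolynomial-root : ∀ d {x} → x ^ (2 ℕ.+ d) ≈ x → monic (fermatPolynomial d) x ≈ 0#
  fermatPolynomial-root d {x} x^[2+d]≈x = begin
    0# + x * (- 1# + x * monic (Vec.replicate d 0#) x)
      ≈⟨ +-congˡ (*-congˡ (+-congˡ (*-congˡ (monic-replicate-0 d x)))) ⟩
    0# + x * (- 1# + x * x ^ d)                         ≈⟨ solve 2 (λ x y →
        con (+ 0) :+ x :* (:- con (+ 1) :+ x :* y) := x :* (x :* y) :- x) refl x (x ^ d) ⟩
    x ^ (2 ℕ.+ d) - x                                   ≈⟨ x≈y⇒x-y≈0 x^[2+d]≈x ⟩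
    0#                                                  ∎

-- Fermat's little theorem and the Frobenius endomorphism

prime∤! : ∀ {p} → Prime p → ∀ {m} → m ℕ.< p → ¬ (p ℕ.∣ m !)
prime∤! pr {zero}  0<p p∣1 = ℕ.<⇒≱ (ℕ.nonTrivial⇒n>1 _ {{prime⇒nonTrivial pr}}) (ℕ.∣⇒≤ p∣1)
prime∤! pr {suc m} m<p p∣m! with euclidsLemma (suc m) (m !) pr p∣m!
... | inj₁ p∣1+m = ℕ.<⇒≱ m<p (ℕ.∣⇒≤ p∣1+m)
... | inj₂ p∣m!′ = prime∤! pr (ℕ.<-trans (ℕ.n<1+n m) m<p) p∣m!′

-- The prime divides p! = (p C k) k! (p - k)!, but neither factorial on the right, since all their
-- factors are below p.
prime∣C : ∀ {p k} → Prime p → 0 ℕ.< k → k ℕ.< p → p ℕ.∣ (p C k)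
prime∣C {p@(suc p-1)} {k} pr 0<k k<p with euclidsLemma (p C k) (k ! ℕ.* (p ℕ.∸ k) !) pr p∣C*d
  where
  instance
    d≢0 = ℕ._!*_!≢0 k (p ℕ.∸ k)
  C*d≡p! : (p C k) ℕ.* (k ! ℕ.* (p ℕ.∸ k) !) ≡ p !
  C*d≡p! = ≡.trans (≡.cong (ℕ._* (k ! ℕ.* (p ℕ.∸ k) !)) (nCk≡n!/k![n-k]! (ℕ.<⇒≤ k<p)))
             (ℕ.m/n*n≡m (k![n∸k]!∣n! (ℕ.<⇒≤ k<p)))
  p∣C*d : p ℕ.∣ (p C k) ℕ.* (k ! ℕ.* (p ℕ.∸ k) !)
  p∣C*d = ≡.subst (p ℕ.∣_) (≡.sym C*d≡p!) (ℕ.m∣m*n (p-1 !))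
... | inj₁ p∣C = p∣C
... | inj₂ p∣d with euclidsLemma (k !) ((p ℕ.∸ k) !) pr p∣d
... | inj₁ p∣k! = contradiction p∣k! (prime∤! pr k<p)
... | inj₂ p∣[p-k]! = contradiction p∣[p-k]! (prime∤! pr (ℕ.∸-monoʳ-< 0<k (ℕ.<⇒≤ k<p)))

module _ (F : CommutativeRing c ℓ) where
  open CommutativeRing F hiding (zero)
  open RingMorphisms rawRing rawRing using (IsRingHomomorphism)
  open CommutativeMonoidSum +-commutativeMonoid
    using (sum; sum-replicate; ∑-distrib-+; sum-cong-≋; sum-replicate-zero; sum-init-last)
  open Algebra.Properties.Semiring.Mult semiring renaming (_×_ to _·_)
  open Exp semiring using (_^_; ^-congˡ; ^-assocʳ)
  open IntegerCoefficients F using (solve; _:+_; _:*_; _:-_; :-_; _:=_; con)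
  open SetoidReasoning setoid

  1^n≈1 : ∀ n → 1# ^ n ≈ 1#
  1^n≈1 zero    = refl
  1^n≈1 (suc n) = trans (*-identityˡ _) (1^n≈1 n)

  isRingHomomorphism : ∀ {φ} → (∀ {x y} → x ≈ y → φ x ≈ φ y) → (∀ x y → φ (x + y) ≈ φ x + φ y) →
                       (∀ x y → φ (x * y) ≈ φ x * φ y) → φ 1# ≈ 1# → IsRingHomomorphism φ
  isRingHomomorphism {φ} cong +-homo *-homo 1-homo = record
    { isSemiringHomomorphism = record
      { isNearSemiringHomomorphism = record
        { +-isMonoidHomomorphism = record
          { isMagmaHomomorphism = record
            { isRelHomomorphism = record { cong = cong }
            ; homo = +-homo
            }
          ; ε-homo = 0-homo
          }
        ; *-homo = *-homo
        }
      ; 1#-homo = 1-homo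
      }
    ; -‿homo = λ x → begin
        φ (- x)                ≈⟨ solve 2 (λ x y → y := x :+ y :- x) refl (φ x) (φ (- x)) ⟩
        φ x + φ (- x) - φ x    ≈⟨ +-congʳ (+-homo x (- x)) ⟨
        φ (x - x) - φ x        ≈⟨ +-congʳ (trans (cong (-‿inverseʳ x)) 0-homo) ⟩
        0# - φ x               ≈⟨ +-identityˡ _ ⟩
        - φ x                  ∎
    }
    where
    0-homo : φ 0# ≈ 0#
    0-homo = begin
      φ 0#                  ≈⟨ solve 1 (λ x → x := x :+ x :- x) refl (φ 0#) ⟩
      φ 0# + φ 0# - φ 0#    ≈⟨ +-congʳ (+-homo 0# 0#) ⟨
      φ (0# + 0#) - φ 0#    ≈⟨ +-congʳ (cong (+-identityˡ 0#)) ⟩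
      φ 0# - φ 0#           ≈⟨ -‿inverseʳ _ ⟩
      0#                    ∎

  module PrimeCharacteristic {p : ℕ} (pr : Prime p) (p·1≈0 : p · 1# ≈ 0#) where

    p∣m⇒m·x≈0 : ∀ {m} x → p ℕ.∣ m → m · x ≈ 0#
    p∣m⇒m·x≈0 x (ℕ.divides r ≡.refl) = begin
      (r ℕ.* p) · x         ≈⟨ ×-assocˡ x r p ⟨
      r · (p · x)           ≈⟨ ×-congʳ r (×-congʳ p (*-identityˡ x)) ⟨
      r · (p · (1# * x))    ≈⟨ ×-congʳ r (×-assoc-* p 1# x) ⟨
      r · (p · 1# * x)      ≈⟨ ×-congʳ r (*-congʳ p·1≈0) ⟩
      r · (0# * x)          ≈⟨ ×-comm-* r 0# x ⟨
      0# * (r · x)          ≈⟨ zeroˡ _ ⟩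
      0#                    ∎

    -- All binomial coefficients except the first and the last are multiples of p and vanish.
    ^p-+-homo : ∀ x y → (x + y) ^ p ≈ x ^ p + y ^ p
    ^p-+-homo x y = helper p ≡.refl
      where
      open Binomial commutativeSemiring using (theorem)
      -- The exponent is generalised so that it can be matched as a successor, which splits off the
      -- last term of the sum.
      helper : ∀ n → n ≡ p → (x + y) ^ n ≈ x ^ n + y ^ n
      helper zero    0≡p = contradiction (≡.subst Prime (≡.sym 0≡p) pr) λ ()
      helper (suc n) ≡.refl = begin
        (x + y) ^ p                                        ≈⟨ theorem p x y ⟩
        sum term                                           ≈⟨ +-congˡ (sum-init-last (term ∘ suc)) ⟩
        term zero + (sum middle + term (suc (Fin.fromℕ n)))  ≈⟨ +-cong first≈ (+-cong middle≈0 last≈) ⟩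
        y ^ p + (0# + x ^ p)
          ≈⟨ solve 2 (λ s t → t :+ (con (+ 0) :+ s) := s :+ t) refl (x ^ p) (y ^ p) ⟩
        x ^ p + y ^ p                                      ∎
        where
        term : Fin (suc p) → Carrier
        term k = (p C Fin.toℕ k) · (x ^ Fin.toℕ k * y ^ (p ℕ.∸ Fin.toℕ k))
        middle : Fin n → Carrier
        middle k = term (suc (Fin.inject₁ k))
        first≈ : term zero ≈ y ^ p
        first≈ = trans (+-identityʳ _) (*-identityˡ _)
        last≈ : term (suc (Fin.fromℕ n)) ≈ x ^ p
        last≈ rewrite Fin.toℕ-fromℕ n | nCn≡1 p | ℕ.n∸n≡0 n = trans (+-identityʳ _) (*-identityʳ _)
        middle≈0 : sum middle ≈ 0#
        middle≈0 = trans
          (sum-cong-≋ {n} (λ k → p∣m⇒m·x≈0 _ (prime∣C pr z<s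
            (s<s (≡.subst (ℕ._< n) (≡.sym (Fin.toℕ-inject₁ k)) (Fin.toℕ<n k))))))
          (sum-replicate-zero n)

    frobenius-isRingHomomorphism : ∀ k → IsRingHomomorphism (_^ (p ℕ.^ k))
    frobenius-isRingHomomorphism k = isRingHomomorphism (^-congˡ (p ℕ.^ k)) (+-homo k)
      (λ x y → CommutativeExp.^-distrib-* commutativeSemiring x y (p ℕ.^ k)) (1^n≈1 (p ℕ.^ k))
      where
      +-homo : ∀ k x y → (x + y) ^ (p ℕ.^ k) ≈ x ^ (p ℕ.^ k) + y ^ (p ℕ.^ k)
      +-homo zero    x y = trans (*-identityʳ _) (sym (+-cong (*-identityʳ x) (*-identityʳ y)))
      +-homo (suc k) x y = begin
        (x + y) ^ (p ℕ.* p ℕ.^ k)                          ≈⟨ ^-assocʳ (x + y) p _ ⟨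
        ((x + y) ^ p) ^ (p ℕ.^ k)                          ≈⟨ ^-congˡ (p ℕ.^ k) (^p-+-homo x y) ⟩
        (x ^ p + y ^ p) ^ (p ℕ.^ k)                        ≈⟨ +-homo k (x ^ p) (y ^ p) ⟩
        (x ^ p) ^ (p ℕ.^ k) + (y ^ p) ^ (p ℕ.^ k)          ≈⟨ +-cong (^-assocʳ x p _) (^-assocʳ y p _) ⟩
        x ^ (p ℕ.* p ℕ.^ k) + y ^ (p ℕ.* p ℕ.^ k)          ∎

  -- Translation by `1#` permutes the m elements, so adding m copies of `1#` leaves their sum
  -- unchanged.
  order·1≈0 : ∀ {m} → HasOrder setoid m → m · 1# ≈ 0#
  order·1≈0 {m} finite = begin
    m · 1#                              ≈⟨ solve 2 (λ x y → x := x :+ y :- y) refl (m · 1#) (sum element) ⟩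
    m · 1# + sum element - sum element  ≈⟨ +-congʳ m·1+sum≈sum ⟩
    sum element - sum element           ≈⟨ -‿inverseʳ _ ⟩
    0#                                  ∎
    where
    open FiniteSetoid finite
    translation : Inverse setoid setoid
    translation = record
      { to        = λ x → 1# + x
      ; from      = λ x → - 1# + x
      ; to-cong   = +-congˡ
      ; from-cong = +-congˡ
      ; inverse   = (λ {x} y≈ → trans (+-congˡ y≈) (solve 1 (λ x → con (+ 1) :+ (:- con (+ 1) :+ x) := x) refl x))
                  , (λ {x} y≈ → trans (+-congˡ y≈) (solve 1 (λ x → :- con (+ 1) :+ (con (+ 1) :+ x) := x) refl x))
      }
    m·1+sum≈sum : m · 1# + sum element ≈ sum element
    m·1+sum≈sum = begin
      m · 1# + sum element                        ≈⟨ +-congʳ (sum-replicate m) ⟨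
      sum {m} (λ _ → 1#) + sum element            ≈⟨ ∑-distrib-+ {m} (λ _ → 1#) element ⟨
      sum (λ i → 1# + element i)                  ≈⟨ sum-reindex +-commutativeMonoid finite translation id id ⟨
      sum element                                 ∎

  module Fermat (isField : IsField F) (_≟ᶠ_ : Decidable _≈_) {K : Pred Carrier κ} (isSubfield : IsSubfield F K)
                {m : ℕ} (finite : HasSize setoid K m) where
    open IsField isField
    open IsSubfield isSubfield
    open CommutativeMonoidSum *-commutativeMonoid using ()
      renaming (sum to product; sum-replicate to product-replicate;
                ∑-distrib-+ to ∏-distrib-*; sum-cong-≋ to product-cong)

    S : Setoid (c ⊔ κ) ℓ
    S = On.setoid {B = ∃ K} setoid proj₁

    open FiniteSetoid {S = S} finite
    open FieldProperties F isField _≟ᶠ_ using (_⁻¹; ⁻¹-inverseʳ; ⁻¹-inverseˡ; *-≉0; *-cancelʳ)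

    ≈0? : ∀ (x : ∃ K) → Dec (proj₁ x ≈ 0#)
    ≈0? x = x ≟ (0# , 0∈)

    -- Replacing 0 by 1 lets a product over the given enumeration of all of `K` equal the product of
    -- the nonzero elements.
    unitPart : ∃ K → Carrier
    unitPart x with ≈0? x
    ... | yes _ = 1#
    ... | no  _ = proj₁ x

    unitPart≉0 : ∀ x → unitPart x ≉ 0#
    unitPart≉0 x with ≈0? x
    ... | yes _   = 1≉0
    ... | no  x≉0 = x≉0

    unitPart-cong : ∀ {x y} → proj₁ x ≈ proj₁ y → unitPart x ≈ unitPart y
    unitPart-cong {x} {y} x≈y with ≈0? x | ≈0? y
    ... | yes _   | yes _   = refl
    ... | no  _   | no  _   = x≈y
    ... | yes x≈0 | no  y≉0 = contradiction (trans (sym x≈y) x≈0) y≉0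
    ... | no  x≉0 | yes y≈0 = contradiction (trans x≈y y≈0) x≉0

    dilation : ∀ {x} → K x → x ≉ 0# → Inverse S S
    dilation {x} x∈K x≉0 = record
      { to        = λ (y , y∈K) → x * y , *-closed x∈K y∈K
      ; from      = λ (y , y∈K) → x ⁻¹ * y , *-closed (⁻¹-closed x∈K (⁻¹-inverseʳ x≉0)) y∈K
      ; to-cong   = *-congˡ
      ; from-cong = *-congˡ
      ; inverse   = (λ {y} z≈ → trans (*-congˡ z≈) (cancel (⁻¹-inverseʳ x≉0) (proj₁ y)))
                  , (λ {y} z≈ → trans (*-congˡ z≈) (cancel (⁻¹-inverseˡ x≉0) (proj₁ y)))
      }
      where
      cancel : ∀ {u v} → u * v ≈ 1# → ∀ y → u * (v * y) ≈ y
      cancel uv≈1 y = trans (sym (*-assoc _ _ _)) (trans (*-congʳ uv≈1) (*-identityˡ y))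

    product-unitPart≉0 : ∀ {n} (t : Fin n → ∃ K) → product (unitPart ∘ t) ≉ 0#
    product-unitPart≉0 {zero}  t = 1≉0
    product-unitPart≉0 {suc n} t = *-≉0 (unitPart≉0 (t zero)) (product-unitPart≉0 (t ∘ suc))

    -- The correction at 0: there `x * unitPart y` is x, while the unit part of `x * y` is 1.
    spike : Carrier → ∃ K → Carrier
    spike x y with ≈0? y
    ... | yes _ = x
    ... | no  _ = 1#

    unitPart-dilation : ∀ {x} (x∈K : K x) (x≉0 : x ≉ 0#) y →
                        x * unitPart y ≈ spike x y * unitPart (Inverse.to (dilation x∈K x≉0) y)
    unitPart-dilation {x} x∈K x≉0 y with ≈0? y | ≈0? (Inverse.to (dilation x∈K x≉0) y)
    ... | yes y≈0 | yes _    = refl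
    ... | yes y≈0 | no  xy≉0 = contradiction (trans (*-congˡ y≈0) (zeroʳ x)) xy≉0
    ... | no  y≉0 | yes xy≈0 = contradiction xy≈0 (*-≉0 x≉0 y≉0)
    ... | no  y≉0 | no  _    = sym (*-identityˡ _)

    product-spike : ∀ x → product (spike x ∘ element) ≈ x
    product-spike x = trans (sum-spike *-commutativeMonoid (spike x ∘ element) i₀ off) on
      where
      i₀ : Fin m
      i₀ = index (0# , 0∈)
      off : ∀ j → j ≢ i₀ → spike x (element j) ≈ 1#
      off j j≢i₀ with ≈0? (element j)
      ... | yes eⱼ≈0 = contradiction (≡.trans (≡.sym (index-element j)) (Inverse.from-cong finite eⱼ≈0)) j≢i₀
      ... | no  _    = refl
      on : spike x (element i₀) ≈ x
      on with ≈0? (element i₀)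
      ... | yes _   = refl
      ... | no  e≉0 = contradiction (element-index (0# , 0∈)) e≉0

    -- Let P be the product of the nonzero elements. Dilation by x permutes `K`, and the entry at 0
    -- contributes one stray x, so x^m P = x P.
    fermat-≉0 : ∀ {x} → K x → x ≉ 0# → x ^ m ≈ x
    fermat-≉0 {x} x∈K x≉0 = *-cancelʳ (product-unitPart≉0 element) (begin
      x ^ m * product (unitPart ∘ element)                      ≈⟨ *-congʳ (product-replicate m) ⟨
      product {m} (λ _ → x) * product (unitPart ∘ element)      ≈⟨ ∏-distrib-* {m} (λ _ → x) (unitPart ∘ element) ⟨
      product (λ i → x * unitPart (element i))
        ≈⟨ product-cong {m} (λ i → unitPart-dilation x∈K x≉0 (element i)) ⟩
      product (λ i → spike x (element i) * unitPart (Inverse.to (dilation x∈K x≉0) (element i)))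
        ≈⟨ ∏-distrib-* (spike x ∘ element) (unitPart ∘ Inverse.to (dilation x∈K x≉0) ∘ element) ⟩
      product (spike x ∘ element) * product (unitPart ∘ Inverse.to (dilation x∈K x≉0) ∘ element)
        ≈⟨ *-cong (product-spike x)
          (sym (sum-reindex *-commutativeMonoid finite (dilation x∈K x≉0) unitPart (λ {y} {z} → unitPart-cong {y} {z}))) ⟩
      x * product (unitPart ∘ element)                          ∎)

    fermat : ∀ {x} → K x → x ^ m ≈ x
    fermat {x} x∈K with x ≟ᶠ 0#
    ... | no  x≉0 = fermat-≉0 x∈K x≉0
    -- An index for 0 forces `m` to be a successor, so the exponent is positive and the power of 0
    -- is 0.
    ... | yes x≈0 with index (0# , 0∈)
    ... | zero  = trans (*-congʳ x≈0) (trans (zeroˡ _) (sym x≈0))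
    ... | suc _ = trans (*-congʳ x≈0) (trans (zeroˡ _) (sym x≈0))

-- Endomorphisms of odd order

module _ (F : CommutativeRing c ℓ) where
  open CommutativeRing F hiding (zero)

  IsEndomorphism : (Carrier → Carrier) → Set (c ⊔ ℓ)
  IsEndomorphism = IsRingHomomorphism
    where open RingMorphisms rawRing rawRing using (IsRingHomomorphism)

  HasPeriod : (Carrier → Carrier) → ℕ → Set (c ⊔ ℓ)
  HasPeriod φ m = ∀ x → fold x φ m ≈ x

  module OddOrderEndomorphism (isField : IsField F) (_≟_ : Decidable _≈_) {φ : Carrier → Carrier}
    (isEndomorphism : IsEndomorphism φ) (j : ℕ) (φ^[1+2j]≈id : HasPeriod φ (1 ℕ.+ j ℕ.* 2)) where

    open IsField isField
    open RingMorphisms rawRing rawRing using (module IsRingHomomorphism)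
    open IsRingHomomorphism isEndomorphism renaming (⟦⟧-cong to φ-cong)
    open FieldProperties F isField _≟_
    open IntegerCoefficients F using (solve; _:+_; _:*_; _:-_; :-_; _:=_; con)
    open SetoidReasoning setoid

    φ-≉0 : ∀ {x} → x ≉ 0# → φ x ≉ 0#
    φ-≉0 {x} x≉0 φx≈0 = 1≉0 (begin
      1#               ≈⟨ 1#-homo ⟨
      φ 1#             ≈⟨ φ-cong (⁻¹-inverseʳ x≉0) ⟨
      φ (x * x ⁻¹)     ≈⟨ *-homo x (x ⁻¹) ⟩
      φ x * φ (x ⁻¹)   ≈⟨ *-congʳ φx≈0 ⟩
      0# * φ (x ⁻¹)    ≈⟨ zeroˡ _ ⟩
      0#               ∎)

    -- φ(u) φ³(u) ⋯ φ²ⁱ⁻¹(u)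
    oddPart : ℕ → Carrier → Carrier
    oddPart zero    u = 1#
    oddPart (suc i) u = φ u * φ (φ (oddPart i u))

    oddPart-cong : ∀ i {u v} → u ≈ v → oddPart i u ≈ oddPart i v
    oddPart-cong zero    u≈v = refl
    oddPart-cong (suc i) u≈v = *-cong (φ-cong u≈v) (φ-cong (φ-cong (oddPart-cong i u≈v)))

    oddPart-≉0 : ∀ i {u} → u ≉ 0# → oddPart i u ≉ 0#
    oddPart-≉0 zero    u≉0 = 1≉0
    oddPart-≉0 (suc i) u≉0 = *-≉0 (φ-≉0 u≉0) (φ-≉0 (φ-≉0 (oddPart-≉0 i u≉0)))

    -- The sign is (-1)^i, but it need not be tracked: in `root` the odd part occurs once under `φ`
    -- and once inverted, so either sign cancels.
    oddPart-neg : ∀ i u → oddPart i (- u) ≈ oddPart i u ⊎ oddPart i (- u) ≈ - oddPart i u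
    oddPart-neg zero    u = inj₁ refl
    oddPart-neg (suc i) u with oddPart-neg i u
    ... | inj₁ even = inj₂ (begin
      φ (- u) * φ (φ (oddPart i (- u)))    ≈⟨ *-cong (-‿homo u) (φ-cong (φ-cong even)) ⟩
      - φ u * φ (φ (oddPart i u))          ≈⟨ solve 2 (λ x y → :- x :* y := :- (x :* y)) refl _ _ ⟩
      - (φ u * φ (φ (oddPart i u)))        ∎)
    ... | inj₂ odd  = inj₁ (begin
      φ (- u) * φ (φ (oddPart i (- u)))    ≈⟨ *-cong (-‿homo u) (φ-cong (φ-cong odd)) ⟩
      - φ u * φ (φ (- oddPart i u))        ≈⟨ *-congˡ (trans (φ-cong (-‿homo _)) (-‿homo _)) ⟩
      - φ u * - φ (φ (oddPart i u))        ≈⟨ solve 2 (λ x y → :- x :* :- y := x :* y) refl _ _ ⟩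
      φ u * φ (φ (oddPart i u))            ∎)

    -- u φ(u) φ²(u) ⋯ φ²ⁱ(u)
    partialNorm : ℕ → Carrier → Carrier
    partialNorm i u = u * (oddPart i u * φ (oddPart i u))

    -- Both sides are u φ(u) ⋯ φ²ⁱ⁺¹(u). At i = j the last factor is u again, and cancelling it
    -- makes the full product `φ`-fixed.
    φ-partialNorm : ∀ i u → φ (partialNorm i u) * u ≈ partialNorm i u * fold u φ (1 ℕ.+ i ℕ.* 2)
    φ-partialNorm zero u = begin
      φ (u * (1# * φ 1#)) * u      ≈⟨ *-congʳ (φ-cong (*-congˡ (trans (*-identityˡ _) 1#-homo))) ⟩
      φ (u * 1#) * u               ≈⟨ *-congʳ (φ-cong (*-identityʳ u)) ⟩
      φ u * u                      ≈⟨ solve 2 (λ x y → y :* x := x :* (con (+ 1) :* con (+ 1)) :* y) refl u (φ u) ⟩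
      u * (1# * 1#) * φ u          ≈⟨ *-congʳ (*-congˡ (*-congˡ 1#-homo)) ⟨
      u * (1# * φ 1#) * φ u        ∎
    φ-partialNorm (suc i) u = begin
      φ (partialNorm (suc i) u) * u                                ≈⟨ *-congʳ (φ-cong step) ⟩
      φ (φ (φ n) * (u * φ u)) * u
        ≈⟨ *-congʳ (trans (*-homo _ _) (*-congˡ (*-homo _ _))) ⟩
      φ (φ (φ n)) * (φ u * φ (φ u)) * u
        ≈⟨ solve 4 (λ a b c d → a :* (b :* c) :* d := (a :* c) :* (d :* b)) refl _ _ _ _ ⟩
      φ (φ (φ n)) * φ (φ u) * (u * φ u)                            ≈⟨ *-congʳ (φ²-* (φ n) u) ⟨
      φ (φ (φ n * u)) * (u * φ u)
        ≈⟨ *-congʳ (φ-cong (φ-cong (φ-partialNorm i u))) ⟩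
      φ (φ (n * fold u φ (1 ℕ.+ i ℕ.* 2))) * (u * φ u)             ≈⟨ *-congʳ (φ²-* n _) ⟩
      φ (φ n) * φ (φ (fold u φ (1 ℕ.+ i ℕ.* 2))) * (u * φ u)
        ≈⟨ solve 3 (λ a b c → (a :* b) :* c := (a :* c) :* b) refl _ _ _ ⟩
      φ (φ n) * (u * φ u) * fold u φ (1 ℕ.+ suc i ℕ.* 2)           ≈⟨ *-congʳ step ⟨
      partialNorm (suc i) u * fold u φ (1 ℕ.+ suc i ℕ.* 2)         ∎
      where
      n = partialNorm i u
      d = oddPart i u
      φ²-* : ∀ x y → φ (φ (x * y)) ≈ φ (φ x) * φ (φ y)
      φ²-* x y = trans (φ-cong (*-homo x y)) (*-homo _ _)
      -- The first two conjugates are split off; what remains is φ² of the shorter product.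
      step : partialNorm (suc i) u ≈ φ (φ n) * (u * φ u)
      step = begin
        u * (φ u * φ (φ d) * φ (φ u * φ (φ d)))              ≈⟨ *-congˡ (*-congˡ (*-homo _ _)) ⟩
        u * (φ u * φ (φ d) * (φ (φ u) * φ (φ (φ d))))
          ≈⟨ solve 5 (λ a b c d e → a :* (b :* c :* (d :* e)) := d :* (c :* e) :* (a :* b)) refl _ _ _ _ _ ⟩
        φ (φ u) * (φ (φ d) * φ (φ (φ d))) * (u * φ u)        ≈⟨ *-congʳ (*-congˡ (φ²-* d (φ d))) ⟨
        φ (φ u) * φ (φ (d * φ d)) * (u * φ u)                ≈⟨ *-congʳ (φ²-* u _) ⟨
        φ (φ n) * (u * φ u)                                  ∎

    C : Carrier → Carrier
    C = oddPart j

    norm : Carrier → Carrier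
    norm = partialNorm j

    φ-norm : ∀ {u} → u ≉ 0# → φ (norm u) ≈ norm u
    φ-norm {u} u≉0 = *-cancelʳ u≉0 (trans (φ-partialNorm j u) (*-congˡ (φ^[1+2j]≈id u)))

    -- Since `norm u` is u · C(u) · φ(C(u)) and is fixed by `φ`, the inverse of C(u) serves as h.
    fixed-decomposition : ∀ {u} → u ≉ 0# → ∃[ h ] ∃[ u₀ ] h ≉ 0# × u₀ ≉ 0# × φ u₀ ≈ u₀ × h * φ h * u₀ ≈ u
    fixed-decomposition {u} u≉0 =
      C u ⁻¹ , norm u , ⁻¹-≉0 C≉0 , *-≉0 u≉0 (*-≉0 C≉0 (φ-≉0 C≉0)) , φ-norm u≉0 , (begin
        C u ⁻¹ * φ (C u ⁻¹) * (u * (C u * φ (C u)))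
          ≈⟨ solve 5 (λ a b c d e → a :* b :* (c :* (d :* e)) := (d :* a) :* (e :* b) :* c) refl _ _ _ _ _ ⟩
        (C u * C u ⁻¹) * (φ (C u) * φ (C u ⁻¹)) * u    ≈⟨ *-congʳ (*-congˡ (*-homo _ _)) ⟨
        (C u * C u ⁻¹) * φ (C u * C u ⁻¹) * u
          ≈⟨ *-congʳ (*-cong (⁻¹-inverseʳ C≉0) (trans (φ-cong (⁻¹-inverseʳ C≉0)) 1#-homo)) ⟩
        1# * 1# * u                                    ≈⟨ solve 1 (λ u → con (+ 1) :* con (+ 1) :* u := u) refl u ⟩
        u                                              ∎)
      where
      C≉0 : C u ≉ 0#
      C≉0 = oddPart-≉0 j u≉0

    -- u φ(u)⁻¹ φ²(u) ⋯ φ²ʲ(u)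
    root : Carrier → Carrier
    root u = u * (φ (C u) * C u ⁻¹)

    root-cong : ∀ {u v} → u ≈ v → root u ≈ root v
    root-cong u≈v = *-cong u≈v (*-cong (φ-cong (oddPart-cong j u≈v)) (⁻¹-cong (oddPart-cong j u≈v)))

    root-0 : ∀ {u} → u ≈ 0# → root u ≈ 0#
    root-0 u≈0 = trans (*-congʳ u≈0) (zeroˡ _)

    -- In the alternating product everything cancels against its `φ`-image except u and φ²ʲ⁺¹(u) =
    -- u.
    root*φ[root] : ∀ u → root u * φ (root u) ≈ u * u
    root*φ[root] u with u ≟ 0#
    ... | yes u≈0 = trans (*-congʳ (root-0 u≈0)) (trans (zeroˡ _) (sym (trans (*-congʳ u≈0) (zeroˡ u))))
    ... | no  u≉0 = begin
      root u * φ (root u)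
        ≈⟨ *-congˡ (trans (*-homo _ _) (*-congˡ (*-homo _ _))) ⟩
      u * (φ d * d ⁻¹) * (φ u * (φ (φ d) * φ (d ⁻¹)))
        ≈⟨ solve 6 (λ a b c d e f →
          a :* (b :* c) :* (d :* (e :* f)) := a :* (b :* f) :* (d :* e) :* c) refl _ _ _ _ _ _ ⟩
      u * (φ d * φ (d ⁻¹)) * (φ u * φ (φ d)) * d ⁻¹
        ≈⟨ *-congʳ (*-cong (*-congˡ φd*φ[d⁻¹]≈1) φu*φ²d≈u*d) ⟩
      u * 1# * (u * d) * d ⁻¹
        ≈⟨ solve 3 (λ u d e → u :* con (+ 1) :* (u :* d) :* e := u :* u :* (d :* e)) refl u d (d ⁻¹) ⟩
      u * u * (d * d ⁻¹)                                               ≈⟨ *-congˡ (⁻¹-inverseʳ d≉0) ⟩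
      u * u * 1#                                                       ≈⟨ *-identityʳ _ ⟩
      u * u                                                            ∎
      where
      d = C u
      d≉0 : d ≉ 0#
      d≉0 = oddPart-≉0 j u≉0
      φd*φ[d⁻¹]≈1 : φ d * φ (d ⁻¹) ≈ 1#
      φd*φ[d⁻¹]≈1 = trans (sym (*-homo _ _)) (trans (φ-cong (⁻¹-inverseʳ d≉0)) 1#-homo)
      -- This is the invariance of the norm u · d · φ(d) with the factor φ(d) cancelled.
      φu*φ²d≈u*d : φ u * φ (φ d) ≈ u * d
      φu*φ²d≈u*d = *-cancelˡ (φ-≉0 d≉0) (begin
        φ d * (φ u * φ (φ d))    ≈⟨ solve 3 (λ a b c → a :* (b :* c) := b :* (a :* c)) refl _ _ _ ⟩
        φ u * (φ d * φ (φ d))    ≈⟨ *-congˡ (*-homo _ _) ⟨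
        φ u * φ (d * φ d)        ≈⟨ *-homo _ _ ⟨
        φ (norm u)               ≈⟨ φ-norm u≉0 ⟩
        u * (d * φ d)            ≈⟨ solve 3 (λ u d e → u :* (d :* e) := e :* (u :* d)) refl _ _ _ ⟩
        φ d * (u * d)            ∎)

    root-neg : ∀ {u} → u ≉ 0# → root (- u) ≈ - root u
    root-neg {u} u≉0 with oddPart-neg j u
    ... | inj₁ even = begin
      - u * (φ (C (- u)) * C (- u) ⁻¹)   ≈⟨ *-congˡ (*-cong (φ-cong even) (⁻¹-cong even)) ⟩
      - u * (φ (C u) * C u ⁻¹)           ≈⟨ solve 2 (λ x y → :- x :* y := :- (x :* y)) refl _ _ ⟩
      - root u                           ∎
    ... | inj₂ odd  = begin
      - u * (φ (C (- u)) * C (- u) ⁻¹)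
        ≈⟨ *-congˡ (*-cong (trans (φ-cong odd) (-‿homo _)) (trans (⁻¹-cong odd) (sym [-d]⁻¹))) ⟩
      - u * (- φ (C u) * - (C u ⁻¹))
        ≈⟨ solve 3 (λ x y z → :- x :* (:- y :* :- z) := :- (x :* (y :* z))) refl _ _ _ ⟩
      - root u                           ∎
      where
      [-d]⁻¹ : - (C u ⁻¹) ≈ (- C u) ⁻¹
      [-d]⁻¹ = ⁻¹-unique
        (trans (solve 2 (λ x y → :- x :* :- y := x :* y) refl _ _) (⁻¹-inverseʳ (oddPart-≉0 j u≉0)))

    root-≉0 : ∀ {u} → u ≉ 0# → root u ≉ 0#
    root-≉0 u≉0 = *-≉0 u≉0 (*-≉0 (φ-≉0 C≉0) (⁻¹-≉0 C≉0))
      where C≉0 = oddPart-≉0 j u≉0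

    -- Multiplying each value by its `φ`-image gives u² = v², hence u = ±v; as `root` is odd, the
    -- minus sign would force 2 · root v = 0.
    root-injective : 1# + 1# ≉ 0# → ∀ {u v} → root u ≈ root v → u ≈ v
    root-injective 2≉0 {u} {v} eq with v ≟ 0#
    ... | yes v≈0 = [ id , (λ u≈-v → trans u≈-v (trans (-‿cong v≈0) (trans -0≈0 (sym v≈0)))) ]′
      (square-injective u²≈v²)
      where
      -0≈0 : - 0# ≈ 0#
      -0≈0 = solve 0 (:- con (+ 0) := con (+ 0)) refl
      u²≈v² : u * u ≈ v * v
      u²≈v² = trans (sym (root*φ[root] u)) (trans (*-cong eq (φ-cong eq)) (root*φ[root] v))
    ... | no  v≉0 with square-injective
      (trans (sym (root*φ[root] u)) (trans (*-cong eq (φ-cong eq)) (root*φ[root] v)))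
    ... | inj₁ u≈v  = u≈v
    ... | inj₂ u≈-v = contradiction (begin
      (1# + 1#) * root v      ≈⟨ solve 1 (λ x → con (+ 2) :* x := x :+ x) refl (root v) ⟩
      root v + root v         ≈⟨ +-congʳ eq ⟨
      root u + root v         ≈⟨ +-congʳ (trans (root-cong u≈-v) (root-neg v≉0)) ⟩
      - root v + root v       ≈⟨ -‿inverseˡ _ ⟩
      0#                      ∎) (*-≉0 2≉0 (root-≉0 v≉0))

-- Sections of the unital as conics

module _ (F : CommutativeRing c ℓ) where
  open CommutativeRing F hiding (zero)

  -- Abstracts x ↦ x^q with its fixed field `K`; θ σ(θ) is then the norm θ^(q+1).
  record IsInvolution (K : Pred Carrier κ) (σ : Carrier → Carrier) : Set (c ⊔ ℓ ⊔ κ) where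
    field
      isEndomorphism : IsEndomorphism F σ
      involutive     : HasPeriod F σ 2
      fixed⇒K        : ∀ {x} → σ x ≈ x → K x
      K⇒fixed        : ∀ {x} → K x → σ x ≈ x

  module Conic (isField : IsField F) (_≟_ : Decidable _≈_) (1+1≉0 : 1# + 1# ≉ 0#)
    {K : Pred Carrier κ} (isSubfield : IsSubfield F K) {σ : Carrier → Carrier} (isInvolution : IsInvolution K σ)
    {θ : Carrier} (θ≉0 : θ ≉ 0#) (norm-nonsquare : ¬ IsSquareIn F K (θ * σ θ)) where

    open IsField isField
    open IsSubfield isSubfield
    open RingMorphisms rawRing rawRing using (module IsRingHomomorphism)
    open IsInvolution isInvolution
    open IsRingHomomorphism isEndomorphism renaming (⟦⟧-cong to σ-cong)
    open FieldProperties F isField _≟_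
    open IntegerCoefficients F using (solve; _:+_; _:*_; _:-_; :-_; _:=_; con)
    open SetoidReasoning setoid

    Kθ : Pred Carrier (c ⊔ ℓ ⊔ κ)
    Kθ z = ∃[ t ] K t × z ≈ t * θ

    K-⁻¹ : ∀ {x} → x ≉ 0# → K x → K (x ⁻¹)
    K-⁻¹ x≉0 x∈K = ⁻¹-closed x∈K (⁻¹-inverseʳ x≉0)

    -- Multiplying u² = tθ by its image under `σ` gives n² = t² θ σ(θ) with n = u σ(u) in `K`. For u
    -- ≠ 0 this would exhibit θ σ(θ) as the square of n/t.
    square∈Kθ⇒≈0 : ∀ {u} → Kθ (u * u) → u ≈ 0#
    square∈Kθ⇒≈0 {u} (t , t∈K , u²≈tθ) with u ≟ 0#
    ... | yes u≈0 = u≈0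
    ... | no  u≉0 = contradiction (n * t ⁻¹ , *-closed n∈K (K-⁻¹ t≉0 t∈K) , square) norm-nonsquare
      where
      n = u * σ u
      n∈K : K n
      n∈K = fixed⇒K (trans (*-homo _ _) (trans (*-congˡ (involutive u)) (*-comm _ _)))
      t≉0 : t ≉ 0#
      t≉0 t≈0 = *-≉0 u≉0 u≉0 (trans u²≈tθ (trans (*-congʳ t≈0) (zeroˡ θ)))
      -- The trailing `1#` comes from unfolding the exponent 2.
      square : n * t ⁻¹ * (n * t ⁻¹ * 1#) ≈ θ * σ θ
      square = begin
        n * t ⁻¹ * (n * t ⁻¹ * 1#)
          ≈⟨ solve 3 (λ u v s →
            u :* v :* s :* (u :* v :* s :* con (+ 1)) := (u :* u) :* (v :* v) :* (s :* s)) refl u (σ u) (t ⁻¹) ⟩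
        (u * u) * (σ u * σ u) * (t ⁻¹ * t ⁻¹)
          ≈⟨ *-congʳ (*-cong u²≈tθ (trans (sym (*-homo u u)) (σ-cong u²≈tθ))) ⟩
        (t * θ) * σ (t * θ) * (t ⁻¹ * t ⁻¹)
          ≈⟨ *-congʳ (*-congˡ (trans (*-homo t θ) (*-congʳ (K⇒fixed t∈K)))) ⟩
        (t * θ) * (t * σ θ) * (t ⁻¹ * t ⁻¹)
          ≈⟨ solve 4 (λ t a b s →
            (t :* a) :* (t :* b) :* (s :* s) := (a :* b) :* ((t :* s) :* (t :* s))) refl _ _ _ _ ⟩
        (θ * σ θ) * ((t * t ⁻¹) * (t * t ⁻¹))
          ≈⟨ *-congˡ (*-cong (⁻¹-inverseʳ t≉0) (⁻¹-inverseʳ t≉0)) ⟩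
        (θ * σ θ) * (1# * 1#)
          ≈⟨ solve 1 (λ x → x :* (con (+ 1) :* con (+ 1)) := x) refl _ ⟩
        θ * σ θ                                             ∎

    -- A `K`-linear form with kernel `Kθ`: it vanishes exactly when z/θ is fixed by `σ`.
    skew : Carrier → Carrier
    skew z = z * σ θ - σ z * θ

    skew≈0⇒Kθ : ∀ {z} → skew z ≈ 0# → Kθ z
    skew≈0⇒Kθ {z} skew≈0 = z * θ ⁻¹ , fixed⇒K fixed , (begin
      z                   ≈⟨ *-identityʳ z ⟨
      z * 1#              ≈⟨ *-congˡ (⁻¹-inverseˡ θ≉0) ⟨
      z * (θ ⁻¹ * θ)      ≈⟨ *-assoc _ _ _ ⟨
      z * θ ⁻¹ * θ        ∎)
      where
      fixed : σ (z * θ ⁻¹) ≈ z * θ ⁻¹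
      fixed = begin
        σ (z * θ ⁻¹)                         ≈⟨ *-homo _ _ ⟩
        σ z * σ (θ ⁻¹)                       ≈⟨ *-identityʳ _ ⟨
        σ z * σ (θ ⁻¹) * 1#                  ≈⟨ *-congˡ (⁻¹-inverseʳ θ≉0) ⟨
        σ z * σ (θ ⁻¹) * (θ * θ ⁻¹)
          ≈⟨ solve 4 (λ a b c d → a :* b :* (c :* d) := (a :* c) :* (b :* d)) refl _ _ _ _ ⟩
        σ z * θ * (σ (θ ⁻¹) * θ ⁻¹)          ≈⟨ *-congʳ (x-y≈0⇒x≈y _ _ skew≈0) ⟨
        z * σ θ * (σ (θ ⁻¹) * θ ⁻¹)
          ≈⟨ solve 4 (λ a b c d → a :* b :* (c :* d) := (a :* d) :* (b :* c)) refl _ _ _ _ ⟩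
        z * θ ⁻¹ * (σ θ * σ (θ ⁻¹))
          ≈⟨ *-congˡ (trans (sym (*-homo _ _)) (trans (σ-cong (⁻¹-inverseʳ θ≉0)) 1#-homo)) ⟩
        z * θ ⁻¹ * 1#                        ≈⟨ *-identityʳ _ ⟩
        z * θ ⁻¹                             ∎

    -- The points u of the conic { u | u² - d² ∈ Kθ } are parametrised by the K-lines
    -- through d, whose directions d + kθd⁻¹ omit only the tangent direction θd⁻¹.
    module Parametrisation {d : Carrier} (d≉0 : d ≉ 0#) where

      private
        v : Carrier
        v = d * d

      skew-v≉0 : skew v ≉ 0#
      skew-v≉0 skew≈0 = d≉0 (square∈Kθ⇒≈0 (skew≈0⇒Kθ skew≈0))

      -- the coordinate along v with respect to the K-basis v, θ of F
      α : Carrier → Carrier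
      α z = skew z * skew v ⁻¹

      α-cong : ∀ {x y} → x ≈ y → α x ≈ α y
      α-cong x≈y = *-congʳ (+-cong (*-congʳ x≈y) (-‿cong (*-congʳ (σ-cong x≈y))))

      α-v : α v ≈ 1#
      α-v = ⁻¹-inverseʳ skew-v≉0

      α≈0⇒Kθ : ∀ {z} → α z ≈ 0# → Kθ z
      α≈0⇒Kθ = skew≈0⇒Kθ ∘ x*y≈0⇒x≈0 (⁻¹-≉0 skew-v≉0)

      α-+ : ∀ x y → α (x + y) ≈ α x + α y
      α-+ x y = begin
        ((x + y) * σ θ - σ (x + y) * θ) * skew v ⁻¹       ≈⟨ *-congʳ (+-congˡ (-‿cong (*-congʳ (+-homo x y)))) ⟩
        ((x + y) * σ θ - (σ x + σ y) * θ) * skew v ⁻¹     ≈⟨ solve 7 (λ x y x′ y′ θ θ′ s →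
            ((x :+ y) :* θ′ :- (x′ :+ y′) :* θ) :* s := (x :* θ′ :- x′ :* θ) :* s :+ (y :* θ′ :- y′ :* θ) :* s)
            refl x y (σ x) (σ y) θ (σ θ) (skew v ⁻¹) ⟩
        α x + α y                                         ∎

      α-* : ∀ {t} → K t → ∀ x → α (t * x) ≈ t * α x
      α-* {t} t∈K x = begin
        (t * x * σ θ - σ (t * x) * θ) * skew v ⁻¹
          ≈⟨ *-congʳ (+-congˡ (-‿cong (*-congʳ (trans (*-homo t x) (*-congʳ (K⇒fixed t∈K)))))) ⟩
        (t * x * σ θ - t * σ x * θ) * skew v ⁻¹           ≈⟨ solve 6 (λ t x x′ θ θ′ s →
            (t :* x :* θ′ :- t :* x′ :* θ) :* s := t :* ((x :* θ′ :- x′ :* θ) :* s))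
            refl t x (σ x) θ (σ θ) (skew v ⁻¹) ⟩
        t * α x                                           ∎

      α-θ : α θ ≈ 0#
      α-θ = solve 3 (λ θ θ′ s → (θ :* θ′ :- θ′ :* θ) :* s := con (+ 0)) refl _ _ _

      Kθ⇒α≈0 : ∀ {z} → Kθ z → α z ≈ 0#
      Kθ⇒α≈0 (t , t∈K , z≈tθ) = trans (α-cong z≈tθ) (trans (α-* t∈K θ) (trans (*-congˡ α-θ) (zeroʳ t)))

      σ-skew : ∀ z → σ (skew z) ≈ - skew z
      σ-skew z = begin
        σ (z * σ θ - σ z * θ)                  ≈⟨ +-homo _ _ ⟩
        σ (z * σ θ) + σ (- (σ z * θ))          ≈⟨ +-cong (*-homo _ _) (trans (-‿homo _) (-‿cong (*-homo _ _))) ⟩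
        σ z * σ (σ θ) - σ (σ z) * σ θ
          ≈⟨ +-cong (*-congˡ (involutive θ)) (-‿cong (*-congʳ (involutive z))) ⟩
        σ z * θ - z * σ θ                      ≈⟨ solve 2 (λ x y → y :- x := :- (x :- y)) refl _ _ ⟩
        - skew z                               ∎

      -- Numerator and denominator are both negated by `σ`, so the quotient is fixed.
      α∈K : ∀ z → K (α z)
      α∈K z = fixed⇒K (*-cancelʳ (-‿≉0 skew-v≉0) (begin
        σ (α z) * - skew v            ≈⟨ *-congˡ (σ-skew v) ⟨
        σ (α z) * σ (skew v)          ≈⟨ *-homo _ _ ⟨
        σ (α z * skew v)              ≈⟨ σ-cong α*skew ⟩
        σ (skew z)                    ≈⟨ σ-skew z ⟩
        - skew z                      ≈⟨ -‿cong α*skew ⟨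
        - (α z * skew v)              ≈⟨ solve 2 (λ x y → :- (x :* y) := x :* :- y) refl _ _ ⟩
        α z * - skew v                ∎))
        where
        α*skew : α z * skew v ≈ skew z
        α*skew = trans (*-assoc _ _ _) (trans (*-congˡ (⁻¹-inverseˡ skew-v≉0)) (*-identityʳ _))

      OnConic : Pred Carrier (c ⊔ ℓ ⊔ κ)
      OnConic u = Kθ (u * u - v)

      2# : Carrier
      2# = 1# + 1#

      -- Written in the displacement e from d, the conic has no constant term. Along e = sg it
      -- becomes s² α(g²) + 2s α(gd) = 0, leaving one point besides d when both coefficients are
      -- nonzero.
      equation : ∀ e → α ((d + e) * (d + e) - v) ≈ α (e * e) + 2# * α (e * d)
      equation e = begin
        α ((d + e) * (d + e) - v)
          ≈⟨ α-cong (solve 2 (λ d e →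
            (d :+ e) :* (d :+ e) :- d :* d := e :* e :+ con (+ 2) :* (e :* d)) refl d e) ⟩
        α (e * e + 2# * (e * d))              ≈⟨ α-+ _ _ ⟩
        α (e * e) + α (2# * (e * d))          ≈⟨ +-congˡ (α-* (+-closed 1∈ 1∈) _) ⟩
        α (e * e) + 2# * α (e * d)            ∎

      module _ (k : ∃ K) where
        -- The representatives g of the non-tangent directions normalised by α(gd) = 1: this means
        -- gd = v + kθ.
        direction : Carrier
        direction = d + proj₁ k * (θ * d ⁻¹)

        direction*d : direction * d ≈ v + proj₁ k * θ
        direction*d = begin
          (d + proj₁ k * (θ * d ⁻¹)) * d
            ≈⟨ solve 4 (λ d k θ i →
              (d :+ k :* (θ :* i)) :* d := d :* d :+ k :* θ :* (i :* d)) refl d (proj₁ k) θ (d ⁻¹) ⟩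
          v + proj₁ k * θ * (d ⁻¹ * d)             ≈⟨ +-congˡ (trans (*-congˡ (⁻¹-inverseˡ d≉0)) (*-identityʳ _)) ⟩
          v + proj₁ k * θ                          ∎

        α-direction*d : α (direction * d) ≈ 1#
        α-direction*d = begin
          α (direction * d)                ≈⟨ α-cong direction*d ⟩
          α (v + proj₁ k * θ)              ≈⟨ α-+ _ _ ⟩
          α v + α (proj₁ k * θ)            ≈⟨ +-cong α-v (Kθ⇒α≈0 (proj₁ k , proj₂ k , refl)) ⟩
          1# + 0#                          ≈⟨ +-identityʳ 1# ⟩
          1#                               ∎

        -- The form α(g²) is anisotropic: if it vanishes, g² lies in `Kθ`, so g = 0, against α(gd) =
        -- 1.
        α-direction²≉0 : α (direction * direction) ≉ 0#
        α-direction²≉0 α≈0 = 1≉0 (trans (sym α-direction*d)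
          (trans (α-cong (trans (*-congʳ (square∈Kθ⇒≈0 (α≈0⇒Kθ α≈0))) (zeroˡ d)))
          (Kθ⇒α≈0 (0# , 0∈ , sym (zeroˡ θ)))))

        -- The nonzero root s of s² α(g²) + 2s = 0.
        scale : Carrier
        scale = - (2# * α (direction * direction) ⁻¹)

        scale∈K : K scale
        scale∈K = -‿closed (*-closed (+-closed 1∈ 1∈) (K-⁻¹ α-direction²≉0 (α∈K _)))

        scale≉0 : scale ≉ 0#
        scale≉0 = -‿≉0 (*-≉0 1+1≉0 (⁻¹-≉0 α-direction²≉0))

        scale*α : scale * α (direction * direction) ≈ - 2#
        scale*α = begin
          - (2# * α (direction * direction) ⁻¹) * α (direction * direction)
            ≈⟨ solve 3 (λ a b c → :- (a :* b) :* c := :- (a :* (b :* c))) refl _ _ _ ⟩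
          - (2# * (α (direction * direction) ⁻¹ * α (direction * direction)))
            ≈⟨ -‿cong (trans (*-congˡ (⁻¹-inverseˡ α-direction²≉0)) (*-identityʳ 2#)) ⟩
          - 2#                                                                 ∎

        secant : Carrier
        secant = scale * direction

        α-secant*d : α (secant * d) ≈ scale
        α-secant*d = begin
          α (scale * direction * d)      ≈⟨ α-cong (*-assoc _ _ _) ⟩
          α (scale * (direction * d))    ≈⟨ α-* scale∈K _ ⟩
          scale * α (direction * d)      ≈⟨ *-congˡ α-direction*d ⟩
          scale * 1#                     ≈⟨ *-identityʳ _ ⟩
          scale                          ∎

        secant-onConic : OnConic (d + secant)
        secant-onConic = α≈0⇒Kθ (begin
          α ((d + secant) * (d + secant) - v)                    ≈⟨ equation secant ⟩
          α (secant * secant) + 2# * α (secant * d)              ≈⟨ +-cong α-secant² (*-congˡ α-secant*d) ⟩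
          scale * (scale * α (direction * direction)) + 2# * scale  ≈⟨ +-congʳ (*-congˡ scale*α) ⟩
          scale * - 2# + 2# * scale
            ≈⟨ solve 2 (λ s t → s :* :- t :+ t :* s := con (+ 0)) refl _ _ ⟩
          0#                                                     ∎)
          where
          α-secant² : α (secant * secant) ≈ scale * (scale * α (direction * direction))
          α-secant² = begin
            α (scale * direction * (scale * direction))
              ≈⟨ α-cong (solve 2 (λ s g → s :* g :* (s :* g) := s :* (s :* (g :* g))) refl _ _) ⟩
            α (scale * (scale * (direction * direction)))    ≈⟨ trans (α-* scale∈K _) (*-congˡ (α-* scale∈K _)) ⟩
            scale * (scale * α (direction * direction))      ∎

      -- A displacement e determines its scale as α(ed), hence its direction, hence the parameter.
      secant-injective : ∀ k k′ → secant k ≈ secant k′ → proj₁ k ≈ proj₁ k′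
      secant-injective k k′ eq = *-cancelʳ θ≉0 (begin
        proj₁ k * θ                     ≈⟨ solve 2 (λ a b → a := b :+ a :- b) refl _ v ⟩
        v + proj₁ k * θ - v             ≈⟨ +-congʳ (direction*d k) ⟨
        direction k * d - v             ≈⟨ +-congʳ (*-congʳ directions≈) ⟩
        direction k′ * d - v            ≈⟨ +-congʳ (direction*d k′) ⟩
        v + proj₁ k′ * θ - v            ≈⟨ solve 2 (λ a b → b :+ a :- b := a) refl _ v ⟩
        proj₁ k′ * θ                    ∎)
        where
        scales≈ : scale k ≈ scale k′
        scales≈ = trans (sym (α-secant*d k)) (trans (α-cong (*-congʳ eq)) (α-secant*d k′))
        directions≈ : direction k ≈ direction k′
        directions≈ = *-cancelˡ (scale≉0 k) (trans eq (*-congʳ (sym scales≈)))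

      -- With e = u - d and ed = sv + rθ, the parameter is r/s. The conclusion covers every `k′`
      -- with an equal underlying element, because the enumeration of `K` returns only such a
      -- representative.
      secant-surjective : ∀ {u} → OnConic u → u ≉ d →
                        ∃ λ (k : ∃ K) → ∀ (k′ : ∃ K) → proj₁ k ≈ proj₁ k′ → d + secant k′ ≈ u
      secant-surjective {u} onConic u≉d = (r * s ⁻¹ , *-closed r∈K (K-⁻¹ s≉0 s∈K)) , λ k k≈ → begin
        d + scale k * direction k    ≈⟨ +-congˡ (*-congʳ (scale≈s k k≈)) ⟩
        d + s * direction k          ≈⟨ +-congˡ (s*direction k k≈) ⟩
        d + e                        ≈⟨ d+e≈u ⟩
        u                            ∎
        where
        e = u - d
        s = α (e * d)
        s∈K = α∈K (e * d)
        d+e≈u : d + e ≈ u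
        d+e≈u = solve 2 (λ d u → d :+ (u :- d) := u) refl d u
        on-equation : α (e * e) + 2# * s ≈ 0#
        on-equation = trans (sym (equation e)) (trans (α-cong (+-congʳ (*-cong d+e≈u d+e≈u))) (Kθ⇒α≈0 onConic))
        -- If s = 0, the displacement is tangent; the conic equation then gives α(e²) = 0, so e = 0
        -- and u = d.
        s≉0 : s ≉ 0#
        s≉0 s≈0 = u≉d (x-y≈0⇒x≈y u d (square∈Kθ⇒≈0 (α≈0⇒Kθ (begin
          α (e * e)                ≈⟨ solve 1 (λ a → a := a :+ con (+ 2) :* con (+ 0)) refl _ ⟩
          α (e * e) + 2# * 0#      ≈⟨ +-congˡ (*-congˡ s≈0) ⟨
          α (e * e) + 2# * s       ≈⟨ on-equation ⟩
          0#                       ∎))))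
        e*d-sv∈Kθ : Kθ (e * d + - s * v)
        e*d-sv∈Kθ = α≈0⇒Kθ (begin
          α (e * d + - s * v)      ≈⟨ α-+ _ _ ⟩
          s + α (- s * v)
            ≈⟨ +-congˡ (trans (α-* (-‿closed s∈K) v) (trans (*-congˡ α-v) (*-identityʳ _))) ⟩
          s - s                    ≈⟨ -‿inverseʳ s ⟩
          0#                       ∎)
        r = proj₁ e*d-sv∈Kθ
        r∈K = proj₁ (proj₂ e*d-sv∈Kθ)
        module _ (k : ∃ K) (k≈ : r * s ⁻¹ ≈ proj₁ k) where
          A = α (direction k * direction k)
          s*direction : s * direction k ≈ e
          s*direction = *-cancelʳ d≉0 (begin
            s * direction k * d                        ≈⟨ *-assoc _ _ _ ⟩
            s * (direction k * d)
              ≈⟨ *-congˡ (trans (direction*d k) (+-congˡ (*-congʳ (sym k≈)))) ⟩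
            s * (v + r * s ⁻¹ * θ)
              ≈⟨ solve 5 (λ s i v r θ → s :* (v :+ r :* i :* θ) := s :* v :+ (s :* i) :* (r :* θ)) refl _ _ _ _ _ ⟩
            s * v + (s * s ⁻¹) * (r * θ)
              ≈⟨ +-congˡ (*-cong (⁻¹-inverseʳ s≉0) (sym (proj₂ (proj₂ e*d-sv∈Kθ)))) ⟩
            s * v + 1# * (e * d + - s * v)
              ≈⟨ solve 3 (λ s v x → s :* v :+ con (+ 1) :* (x :+ :- s :* v) := x) refl _ _ _ ⟩
            e * d                                      ∎)
          α-e² : α (e * e) ≈ s * (s * A)
          α-e² = begin
            α (e * e)                                  ≈⟨ α-cong (*-cong s*direction s*direction) ⟨
            α (s * direction k * (s * direction k))
              ≈⟨ α-cong (solve 2 (λ s g → s :* g :* (s :* g) := s :* (s :* (g :* g))) refl _ _) ⟩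
            α (s * (s * (direction k * direction k)))  ≈⟨ trans (α-* s∈K _) (*-congˡ (α-* s∈K _)) ⟩
            s * (s * A)                                ∎
          scale≈s : scale k ≈ s
          scale≈s = *-cancelʳ (α-direction²≉0 k) (trans (scale*α k)
            (sym (x-y≈0⇒x≈y (s * A) (- 2#) (x*y≈0⇒y≈0 s≉0 (begin
            s * (s * A - - 2#)
              ≈⟨ solve 3 (λ s a t → s :* (a :- :- t) := s :* a :+ t :* s) refl s (s * A) 2# ⟩
            s * (s * A) + 2# * s     ≈⟨ +-congʳ α-e² ⟨
            α (e * e) + 2# * s       ≈⟨ on-equation ⟩
            0#                       ∎)))))

    module _ {q : ℕ} (sizeK : HasSize setoid K q) {d : Carrier} (d≉0 : d ≉ 0#) where
      open Parametrisation d≉0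
      open FiniteSetoid {S = On.setoid {B = ∃ K} setoid proj₁} sizeK
        using (element; index; element-index; element-injective)

      -- The base point d stands in for the tangent direction, which has no parameter k; this brings
      -- the q secants to q + 1 points.
      conic : Fin (suc q) → Carrier
      conic zero    = d
      conic (suc i) = d + secant (element i)

      conic∈ : ∀ i → Kθ (conic i * conic i - d * d)
      conic∈ zero    = 0# , 0∈ , trans (-‿inverseʳ _) (sym (zeroˡ θ))
      conic∈ (suc i) = secant-onConic (element i)

      d+secant≉d : ∀ k → d + secant k ≉ d
      d+secant≉d k eq = scale≉0 k (trans (sym (α-secant*d k)) (Kθ⇒α≈0 (0# , 0∈ , (begin
        secant k * d                 ≈⟨ solve 2 (λ d e → e :* d := (d :+ e :- d) :* d) refl d _ ⟩
        (d + secant k - d) * d       ≈⟨ *-congʳ (x≈y⇒x-y≈0 eq) ⟩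
        0# * d                       ≈⟨ trans (zeroˡ d) (sym (zeroˡ θ)) ⟩
        0# * θ                       ∎))))

      conic-injective : ∀ {i j} → conic i ≈ conic j → i ≡ j
      conic-injective {zero}  {zero}  eq = ≡.refl
      conic-injective {zero}  {suc j} eq = contradiction (sym eq) (d+secant≉d (element j))
      conic-injective {suc i} {zero}  eq = contradiction eq (d+secant≉d (element i))
      conic-injective {suc i} {suc j} eq = ≡.cong suc
        (element-injective (secant-injective (element i) (element j) (begin
        secant (element i)               ≈⟨ solve 2 (λ d e → e := d :+ e :- d) refl d _ ⟩
        d + secant (element i) - d       ≈⟨ +-congʳ eq ⟩
        d + secant (element j) - d       ≈⟨ solve 2 (λ d e → d :+ e :- d := e) refl d _ ⟩
        secant (element j)               ∎)))

      conic-surjective : ∀ {u} → Kθ (u * u - d * d) → ∃[ i ] conic i ≈ u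
      conic-surjective {u} onConic with u ≟ d
      ... | yes u≈d = zero , sym u≈d
      ... | no  u≉d = let k , d+secant≈u = secant-surjective onConic u≉d in
        suc (index k) , d+secant≈u (element (index k)) (sym (element-index k))

-- The configuration

-- The pairs i < j in Fin 4, listed as 01, 23, 02, 13, 03, 12.
lower upper : Fin 6 → Fin 4
lower 0F = 0F
lower 1F = 2F
lower 2F = 0F
lower 3F = 1F
lower 4F = 0F
lower 5F = 1F
upper 0F = 1F
upper 1F = 3F
upper 2F = 2F
upper 3F = 3F
upper 4F = 3F
upper 5F = 2F

-- The last clause is meant for the pair 23; for i ≥ j its value is a placeholder.
pair : Fin 4 → Fin 4 → Fin 6
pair 0F 1F = 0F
pair 0F 2F = 2F
pair 0F 3F = 4F
pair 1F 2F = 5F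
pair 1F 3F = 3F
pair _  _  = 1F

pair-ends : ∀ i j → i < j → lower (pair i j) ≡ i × upper (pair i j) ≡ j
pair-ends = from-yes (Fin.all? λ i → Fin.all? λ j →
  (i <? j) →-dec ((lower (pair i j) Fin.≟ i) ×-dec (upper (pair i j) Fin.≟ j)))

-- Serves both for the blocks and for the four outer abscissas, reducing each to six cases.
pairwise-distinct : ∀ {r} {R : Fin 4 → Fin 4 → Set r} → Symmetric R →
                    (∀ m → ¬ R (lower m) (upper m)) → ∀ i j → R i j → i ≡ j
pairwise-distinct {R = R} R-sym apart i j Rij with Fin.<-cmp i j
... | tri≈ _ i≡j _ = i≡j
... | tri< i<j _ _ = let l≡i , u≡j = pair-ends i j i<j in
  contradiction (≡.subst₂ R (≡.sym l≡i) (≡.sym u≡j) Rij) (apart (pair i j))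
... | tri> _ _ j<i = let l≡j , u≡i = pair-ends j i j<i in
  contradiction (≡.subst₂ R (≡.sym l≡j) (≡.sym u≡i) (R-sym Rij)) (apart (pair j i))

module _ (F : CommutativeRing c ℓ) where
  open CommutativeRing F hiding (zero)

  module Configuration (isField : IsField F) {m : ℕ} (finite : HasOrder setoid m) (1+1≉0 : 1# + 1# ≉ 0#)
    {K : Pred Carrier κ} (isSubfield : IsSubfield F K) {q : ℕ} (sizeK : HasSize setoid K q)
    {σ : Carrier → Carrier} (isInvolution : IsInvolution F K σ)
    {φ : Carrier → Carrier} (isEndomorphism : IsEndomorphism F φ)
    (j : ℕ) (φ^[1+2j]≈id : HasPeriod F φ (1 ℕ.+ j ℕ.* 2))
    {f : Carrier → Carrier} (f≈ : ∀ x → f x ≈ x * φ x)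
    {θ : Carrier} (θ≉0 : θ ≉ 0#) (norm-nonsquare : ¬ IsSquareIn F K (θ * σ θ)) where

    open IsSubfield isSubfield
    open FiniteSetoid {S = setoid} finite using (_≟_; injective⇒surjective)
    open FieldProperties F isField _≟_
    open OddOrderEndomorphism F isField _≟_ isEndomorphism j φ^[1+2j]≈id
    open Conic F isField _≟_ 1+1≉0 isSubfield isInvolution θ≉0 norm-nonsquare
    open RingMorphisms rawRing rawRing using (module IsRingHomomorphism)
    open IsRingHomomorphism isEndomorphism renaming (⟦⟧-cong to φ-cong)
    open IntegerCoefficients F using (Polynomial; solve; _:+_; _:*_; _:-_; :-_; _:=_; con)
    open Algebra.Properties.Semiring.Mult.TCOptimised semiring using () renaming (_×_ to _·_)
    open SetoidReasoning setoid

    -- Sections of the unital by the lines `L s b`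

    U : Pred (Point F) (c ⊔ ℓ ⊔ κ)
    U = 𝒰 F K θ

    infix 4 _≈ₚ_
    _≈ₚ_ : Point F → Point F → Set (c ⊔ ℓ)
    _≈ₚ_ = _≈ᵖ_ F

    module Points = Setoid (pointSetoid F)

    aff≈ : ∀ {x y x′ y′} → x ≈ x′ → y ≈ y′ → aff x y ≈ₚ aff x′ y′
    aff≈ x≈x′ y≈y′ = inj₁ (x≈x′ , y≈y′)

    aff-injective : ∀ {x y x′ y′} → aff x y ≈ₚ aff x′ y′ → x ≈ x′ × y ≈ y′
    aff-injective (inj₁ eq) = eq

    -- `f` is a bare function on the carrier; that it respects equality follows from its formula.
    f-cong : ∀ {x y} → x ≈ y → f x ≈ f y
    f-cong x≈y = trans (f≈ _) (trans (*-cong x≈y (φ-cong x≈y)) (sym (f≈ _)))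

    f-root : ∀ u → f (root u) ≈ u * u
    f-root u = trans (f≈ _) (root*φ[root] u)

    root-surjective : ∀ s → ∃[ u ] root u ≈ s
    root-surjective = injective⇒surjective root root-cong (root-injective 1+1≉0)

    -- The unital contains no direction (s) and the line does not contain (∞), so only affine points
    -- survive.
    on-affine : ∀ {s b P} → section F f U (L s b) P →
                ∃[ x ] ∃[ t ] K t × P ≈ₚ aff x (t * θ) × t * θ ≈ f (x + s) - b
    on-affine (inj₁ (x , t , t∈K , P≈xt) , inj₁ (x′ , P≈x′)) =
      let x≈x′ , tθ≈ = aff-injective (Points.trans (Points.sym P≈xt) P≈x′) in
      x , t , t∈K , P≈xt , trans tθ≈ (+-congʳ (f-cong (+-congʳ (sym x≈x′))))
    on-affine (inj₁ (x , t , t∈K , P≈xt) , inj₂ P≈s) with () ← Points.trans (Points.sym P≈xt) P≈s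
    on-affine (inj₂ P≈∞ , inj₁ (x′ , P≈x′)) with () ← Points.trans (Points.sym P≈∞) P≈x′
    on-affine (inj₂ P≈∞ , inj₂ P≈s) with inj₂ () ← Points.trans (Points.sym P≈∞) P≈s

    affine-on : ∀ {s b x t} → K t → t * θ ≈ f (x + s) - b → section F f U (L s b) (aff x (t * θ))
    affine-on {x = x} {t} t∈K eq = inj₁ (x , t , t∈K , Points.refl) , inj₁ (x , aff≈ refl eq)

    module _ {s b t₀ d : Carrier} (root-d≈s : root d ≈ s) (d≉0 : d ≉ 0#)
             (t₀∈K : K t₀) (fs-b≈t₀θ : f s - b ≈ t₀ * θ) where

      fs≈d² : f s ≈ d * d
      fs≈d² = trans (f-cong (sym root-d≈s)) (f-root d)

      -- The substitution x + s = root u. The parameter u = d gives x = 0, whose point (0, t₀θ) lies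
      -- on the section by assumption; relative to it the ordinates differ by u² - d².
      abscissa : Carrier → Carrier
      abscissa u = root u - s

      abscissa+s : ∀ u → abscissa u + s ≈ root u
      abscissa+s u = solve 2 (λ r s → r :- s :+ s := r) refl (root u) s

      abscissa-injective : ∀ {u v} → abscissa u ≈ abscissa v → u ≈ v
      abscissa-injective {u} {v} eq = root-injective 1+1≉0 (begin
        root u             ≈⟨ abscissa+s u ⟨
        abscissa u + s     ≈⟨ +-congʳ eq ⟩
        abscissa v + s     ≈⟨ abscissa+s v ⟩
        root v             ∎)

      abscissa≈ : ∀ {u x} → root u ≈ x + s → abscissa u ≈ x
      abscissa≈ {u} {x} eq = begin
        root u - s     ≈⟨ +-congʳ eq ⟩
        x + s - s      ≈⟨ solve 2 (λ x s → x :+ s :- s := x) refl x s ⟩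
        x              ∎

      ordinate : ∀ {u t} → u * u - d * d ≈ t * θ → (t + t₀) * θ ≈ f (abscissa u + s) - b
      ordinate {u} {t} onConic = begin
        (t + t₀) * θ                         ≈⟨ distribʳ θ t t₀ ⟩
        t * θ + t₀ * θ                       ≈⟨ +-cong onConic fs-b≈t₀θ ⟨
        u * u - d * d + (f s - b)
          ≈⟨ +-congʳ (+-cong (trans (f-cong (abscissa+s u)) (f-root u)) (-‿cong fs≈d²)) ⟨
        f (abscissa u + s) - f s + (f s - b)
          ≈⟨ solve 3 (λ y z b → y :- z :+ (z :- b) := y :- b) refl (f (abscissa u + s)) (f s) b ⟩
        f (abscissa u + s) - b               ∎

      onConic : ∀ {u x t} → root u ≈ x + s → t * θ ≈ f (x + s) - b → u * u - d * d ≈ (t - t₀) * θ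
      onConic {u} {x} {t} root-u≈ tθ≈ = begin
        u * u - d * d                        ≈⟨ +-cong (trans (f-cong (sym root-u≈)) (f-root u)) (-‿cong fs≈d²) ⟨
        f (x + s) - f s
          ≈⟨ solve 3 (λ y z b → y :- z := (y :- b) :- (z :- b)) refl (f (x + s)) (f s) b ⟩
        f (x + s) - b - (f s - b)            ≈⟨ +-cong (sym tθ≈) (-‿cong fs-b≈t₀θ) ⟩
        t * θ - t₀ * θ                       ≈⟨ solve 3 (λ a b θ → a :* θ :- b :* θ := (a :- b) :* θ) refl t t₀ θ ⟩
        (t - t₀) * θ                         ∎

      module _ (conic : Fin (suc q) → Carrier) (conic∈ : ∀ i → Kθ (conic i * conic i - d * d))
               (conic-injective : ∀ {i j} → conic i ≈ conic j → i ≡ j)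
               (conic-surjective : ∀ {u} → Kθ (u * u - d * d) → ∃[ i ] conic i ≈ u) where

        t : Fin (suc q) → Carrier
        t i = proj₁ (conic∈ i) + t₀

        on-line : ∀ i → t i * θ ≈ f (abscissa (conic i) + s) - b
        on-line i = ordinate (proj₂ (proj₂ (conic∈ i)))

        point : Fin (suc q) → ∃ (section F f U (L s b))
        point i = aff (abscissa (conic i)) (t i * θ) ,
          affine-on (+-closed (proj₁ (proj₂ (conic∈ i))) t₀∈K) (on-line i)

        point-surjective : ∀ (Q : ∃ (section F f U (L s b))) → ∃[ i ] proj₁ (point i) ≈ₚ proj₁ Q
        point-surjective (P , P∈) =
          let x , t′ , t′∈K , P≈ , t′θ≈ = on-affine P∈
              u , root-u≈ = root-surjective (x + s)
              i , conic-i≈u = conic-surjective {u} (t′ - t₀ , +-closed t′∈K (-‿closed t₀∈K) , onConic root-u≈ t′θ≈)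
              x≈ = abscissa≈ (trans (root-cong conic-i≈u) root-u≈)
          in i , Points.trans
            (aff≈ x≈ (trans (on-line i) (trans (+-congʳ (f-cong (+-congʳ x≈))) (sym t′θ≈)))) (Points.sym P≈)

        section-hasSize : HasSize (pointSetoid F) (section F f U (L s b)) (suc q)
        section-hasSize = enumeration⇒hasOrder _ point
          (λ eq → conic-injective (abscissa-injective (proj₁ (aff-injective eq)))) point-surjective

    -- The condition on b places (0, t₀θ) on the line. For s = 0 the base point would be d = 0 and
    -- the conic u² ∈ `Kθ` a single point, so s ≠ 0 is what makes the section a block.
    isBlock-L : ∀ {s b t₀} → s ≉ 0# → K t₀ → f s - b ≈ t₀ * θ → IsBlock F f U q (L s b)
    isBlock-L {s} {b} s≉0 t₀∈K fs-b≈t₀θ =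
      let d , root-d≈s = root-surjective s
          d≉0 = λ d≈0 → s≉0 (trans (sym root-d≈s) (root-0 d≈0))
      in ≡.subst (HasSize (pointSetoid F) (section F f U (L s b))) (ℕ.+-comm 1 q)
        (section-hasSize root-d≈s d≉0 t₀∈K fs-b≈t₀θ
          (conic sizeK d≉0) (conic∈ sizeK d≉0) (conic-injective sizeK d≉0) (conic-surjective sizeK d≉0))

    -- Four lines and their six meeting points

    K-numeral : ∀ n → K (n · 1#)
    K-numeral zero          = 0∈
    K-numeral (suc zero)    = 1∈
    K-numeral (suc (suc n)) = +-closed (K-numeral (suc n)) 1∈

    2≉0 : 2 · 1# ≉ 0#
    2≉0 = 1+1≉0

    4≉0 : 4 · 1# ≉ 0#
    4≉0 4≈0 = *-≉0 2≉0 2≉0 (trans (solve 0 (con (+ 2) :* con (+ 2) := con (+ 4)) refl) 4≈0)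

    8≉0 : 8 · 1# ≉ 0#
    8≉0 8≈0 = *-≉0 2≉0 4≉0 (trans (solve 0 (con (+ 2) :* con (+ 4) := con (+ 8)) refl) 8≈0)

    fixed-+ : ∀ {x y} → φ x ≈ x → φ y ≈ y → φ (x + y) ≈ x + y
    fixed-+ φx≈x φy≈y = trans (+-homo _ _) (+-cong φx≈x φy≈y)

    fixed-neg : ∀ {x} → φ x ≈ x → φ (- x) ≈ - x
    fixed-neg φx≈x = trans (-‿homo _) (-‿cong φx≈x)

    fixed-* : ∀ {x y} → φ x ≈ x → φ y ≈ y → φ (x * y) ≈ x * y
    fixed-* φx≈x φy≈y = trans (*-homo _ _) (*-cong φx≈x φy≈y)

    -- In the coordinates x = h X with X fixed by φ, where θ = h φ(h) θ₀, the function f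
    -- becomes X ↦ h φ(h) X².
    module _ {h θ₀ : Carrier} (h≉0 : h ≉ 0#) (θ₀≉0 : θ₀ ≉ 0#)
             (φθ₀≈θ₀ : φ θ₀ ≈ θ₀) (hφhθ₀≈θ : h * φ h * θ₀ ≈ θ) where

      w : Carrier
      w = h * φ h

      w≉0 : w ≉ 0#
      w≉0 = *-≉0 h≉0 (φ-≉0 h≉0)

      f-h* : ∀ {x} → φ x ≈ x → f (h * x) ≈ w * (x * x)
      f-h* {x} φx≈x = begin
        f (h * x)              ≈⟨ f≈ _ ⟩
        h * x * φ (h * x)      ≈⟨ *-congˡ (trans (*-homo h x) (*-congˡ φx≈x)) ⟩
        h * x * (φ h * x)      ≈⟨ solve 3 (λ h h′ x → h :* x :* (h′ :* x) := h :* h′ :* (x :* x)) refl h (φ h) x ⟩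
        w * (x * x)            ∎

      -- As h is a value of `root`, w = f(h) is a square u². If θ₀ = ε, then w = εθ is a nonzero
      -- square in `Kθ`, which is impossible.
      θ₀≉±1 : ∀ {ε} → K ε → ε * ε ≈ 1# → θ₀ ≉ ε
      θ₀≉±1 {ε} ε∈K ε²≈1 θ₀≈ε =
        let u , root-u≈h = root-surjective h
            u²≈εθ = begin
              u * u              ≈⟨ f-root u ⟨
              f (root u)         ≈⟨ trans (f-cong root-u≈h) (f≈ h) ⟩
              w                  ≈⟨ *-identityʳ w ⟨
              w * 1#             ≈⟨ *-congˡ ε²≈1 ⟨
              w * (ε * ε)        ≈⟨ solve 2 (λ w e → w :* (e :* e) := e :* (w :* e)) refl w ε ⟩
              ε * (w * ε)        ≈⟨ *-congˡ (*-congˡ θ₀≈ε) ⟨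
              ε * (w * θ₀)       ≈⟨ *-congˡ hφhθ₀≈θ ⟩
              ε * θ              ∎
        in h≉0 (trans (sym root-u≈h) (root-0 (square∈Kθ⇒≈0 (ε , ε∈K , u²≈εθ))))

      1+θ₀≉0 : 1# + θ₀ ≉ 0#
      1+θ₀≉0 1+θ₀≈0 = θ₀≉±1 (-‿closed 1∈) (solve 0 (:- con (+ 1) :* :- con (+ 1) := con (+ 1)) refl)
        (x-y≈0⇒x≈y θ₀ (- 1#) (trans (solve 1 (λ x → x :- :- con (+ 1) := con (+ 1) :+ x) refl θ₀) 1+θ₀≈0))

      1-θ₀≉0 : 1# - θ₀ ≉ 0#
      1-θ₀≉0 1-θ₀≈0 = θ₀≉±1 1∈ (*-identityˡ 1#) (sym (x-y≈0⇒x≈y 1# θ₀ 1-θ₀≈0))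

      -- For g fixed by `φ`, w g² = f(hg), so the second parameter makes the line pass through (0,
      -- yθ).
      lineAt : Carrier → Carrier → Line F
      lineAt g y = L (h * g) (w * (g * g) - y * θ)

      f-line : ∀ {g x} y → φ g ≈ g → φ x ≈ x →
               f (h * x + h * g) - (w * (g * g) - y * θ) ≈ w * (x * (x + (g + g)) + y * θ₀)
      f-line {g} {x} y φg≈g φx≈x = begin
        f (h * x + h * g) - (w * (g * g) - y * θ)
          ≈⟨ +-cong (trans (f-cong (sym (distribˡ h x g))) (f-h* (fixed-+ φx≈x φg≈g)))
          (-‿cong (+-congˡ (-‿cong (*-congˡ (sym hφhθ₀≈θ))))) ⟩
        w * ((x + g) * (x + g)) - (w * (g * g) - y * (w * θ₀))    ≈⟨ solve 5 (λ w x g y θ₀ →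
            w :* ((x :+ g) :* (x :+ g)) :- (w :* (g :* g) :- y :* (w :* θ₀)) := w :* (x :* (x :+ (g :+ g)) :+ y :* θ₀))
            refl w x g y θ₀ ⟩
        w * (x * (x + (g + g)) + y * θ₀)                          ∎

      -- The equation of `lineAt g y` at the point (hx, tθ) after cancelling w; the right side is (x
      -- + g)² - g² + yθ₀.
      Incident : Carrier → Carrier → Carrier → Carrier → Set ℓ
      Incident g y x t = t * θ₀ ≈ x * (x + (g + g)) + y * θ₀

      tθ≈w[tθ₀] : ∀ t → t * θ ≈ w * (t * θ₀)
      tθ≈w[tθ₀] t = trans (*-congˡ (sym hφhθ₀≈θ))
        (solve 3 (λ t w θ₀ → t :* (w :* θ₀) := w :* (t :* θ₀)) refl t w θ₀)

      incident⇒section : ∀ {g y x t} → φ g ≈ g → φ x ≈ x → K t → Incident g y x t →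
                         section F f U (lineAt g y) (aff (h * x) (t * θ))
      incident⇒section {y = y} {t = t} φg≈g φx≈x t∈K eq =
        affine-on t∈K (trans (tθ≈w[tθ₀] t) (trans (*-congˡ eq) (sym (f-line y φg≈g φx≈x))))

      section⇒incident : ∀ {g y x t} → φ g ≈ g → φ x ≈ x →
                         section F f U (lineAt g y) (aff (h * x) (t * θ)) → Incident g y x t
      section⇒incident {g} {y} {x} {t} φg≈g φx≈x P∈ =
        let x′ , t′ , _ , P≈ , t′θ≈ = on-affine P∈
            hx≈x′ , tθ≈t′θ = aff-injective P≈
        in *-cancelˡ w≉0 (begin
          w * (t * θ₀)                                    ≈⟨ tθ≈w[tθ₀] t ⟨
          t * θ                                           ≈⟨ tθ≈t′θ ⟩
          t′ * θ                                          ≈⟨ t′θ≈ ⟩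
          f (x′ + h * g) - (w * (g * g) - y * θ)          ≈⟨ +-congʳ (f-cong (+-congʳ hx≈x′)) ⟨
          f (h * x + h * g) - (w * (g * g) - y * θ)       ≈⟨ f-line y φg≈g φx≈x ⟩
          w * (x * (x + (g + g)) + y * θ₀)                ∎)

      -- At t = 4 the equations, with all terms on one side, are in order (X - 2)(X - 2θ₀), (X +
      -- 2)(X + 2θ₀), (X + 2)(X - 2θ₀) and (X - 2)(X + 2θ₀). The gradient is half the linear
      -- coefficient. The constant term ±4θ₀ equals (y - 4)θ₀, so the heights are 8 and 0.
      gradient : Fin 4 → Carrier
      gradient 0F = - (1# + θ₀)
      gradient 1F = 1# + θ₀
      gradient 2F = 1# - θ₀
      gradient 3F = - (1# - θ₀)

      height : Fin 4 → ℕ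
      height 0F = 8
      height 1F = 8
      height 2F = 0
      height 3F = 0

      line : Fin 4 → Line F
      line i = lineAt (gradient i) (height i · 1#)

      outerAbscissa : Fin 4 → Carrier
      outerAbscissa 0F = 2 · 1# * θ₀
      outerAbscissa 1F = - (2 · 1# * θ₀)
      outerAbscissa 2F = 2 · 1#
      outerAbscissa 3F = - (2 · 1#)

      meetAbscissa : Fin 6 → Carrier
      meetAbscissa 0F            = 0#
      meetAbscissa 1F            = 0#
      meetAbscissa (suc (suc i)) = outerAbscissa i

      meetHeight : Fin 6 → ℕ
      meetHeight 0F            = 8
      meetHeight 1F            = 0
      meetHeight (suc (suc _)) = 4

      meetPoint : Fin 6 → Point F
      meetPoint m = aff (h * meetAbscissa m) (meetHeight m · 1# * θ)

      fixed-gradient : ∀ i → φ (gradient i) ≈ gradient i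
      fixed-gradient 0F = fixed-neg (fixed-+ 1#-homo φθ₀≈θ₀)
      fixed-gradient 1F = fixed-+ 1#-homo φθ₀≈θ₀
      fixed-gradient 2F = fixed-+ 1#-homo (fixed-neg φθ₀≈θ₀)
      fixed-gradient 3F = fixed-neg (fixed-+ 1#-homo (fixed-neg φθ₀≈θ₀))

      fixed-outerAbscissa : ∀ i → φ (outerAbscissa i) ≈ outerAbscissa i
      fixed-outerAbscissa 0F = fixed-* (fixed-+ 1#-homo 1#-homo) φθ₀≈θ₀
      fixed-outerAbscissa 1F = fixed-neg (fixed-* (fixed-+ 1#-homo 1#-homo) φθ₀≈θ₀)
      fixed-outerAbscissa 2F = fixed-+ 1#-homo 1#-homo
      fixed-outerAbscissa 3F = fixed-neg (fixed-+ 1#-homo 1#-homo)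

      fixed-meetAbscissa : ∀ m → φ (meetAbscissa m) ≈ meetAbscissa m
      fixed-meetAbscissa 0F            = 0#-homo
      fixed-meetAbscissa 1F            = 0#-homo
      fixed-meetAbscissa (suc (suc i)) = fixed-outerAbscissa i

      gradient≉0 : ∀ i → gradient i ≉ 0#
      gradient≉0 0F = -‿≉0 1+θ₀≉0
      gradient≉0 1F = 1+θ₀≉0
      gradient≉0 2F = 1-θ₀≉0
      gradient≉0 3F = -‿≉0 1-θ₀≉0

      line-isBlock : ∀ i → IsBlock F f U q (line i)
      line-isBlock i = isBlock-L (*-≉0 h≉0 (gradient≉0 i)) (K-numeral (height i)) (begin
        f (h * g) - (w * (g * g) - y * θ)      ≈⟨ +-congʳ (f-h* (fixed-gradient i)) ⟩
        w * (g * g) - (w * (g * g) - y * θ)    ≈⟨ solve 2 (λ a b → a :- (a :- b) := b) refl (w * (g * g)) (y * θ) ⟩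
        y * θ                                  ∎)
        where
        g = gradient i
        y = height i · 1#

      IncidentAt : Fin 4 → Fin 6 → Set ℓ
      IncidentAt i m = Incident (gradient i) (height i · 1#) (meetAbscissa m) (meetHeight m · 1#)

      incident : ∀ {n} (g y x t θ : Polynomial n) → Polynomial n × Polynomial n
      incident g y x t θ = t :* θ := x :* (x :+ (g :+ g)) :+ y :* θ

      lower-incident : ∀ m → IncidentAt (lower m) m
      lower-incident 0F =
        solve 1 (λ θ → incident (:- (con (+ 1) :+ θ)) (con (+ 8)) (con (+ 0)) (con (+ 8)) θ) refl θ₀
      lower-incident 1F =
        solve 1 (λ θ → incident (con (+ 1) :- θ) (con (+ 0)) (con (+ 0)) (con (+ 0)) θ) refl θ₀
      lower-incident 2F =
        solve 1 (λ θ → incident (:- (con (+ 1) :+ θ)) (con (+ 8)) (con (+ 2) :* θ) (con (+ 4)) θ) refl θ₀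
      lower-incident 3F =
        solve 1 (λ θ → incident (con (+ 1) :+ θ) (con (+ 8)) (:- (con (+ 2) :* θ)) (con (+ 4)) θ) refl θ₀
      lower-incident 4F =
        solve 1 (λ θ → incident (:- (con (+ 1) :+ θ)) (con (+ 8)) (con (+ 2)) (con (+ 4)) θ) refl θ₀
      lower-incident 5F =
        solve 1 (λ θ → incident (con (+ 1) :+ θ) (con (+ 8)) (:- con (+ 2)) (con (+ 4)) θ) refl θ₀

      upper-incident : ∀ m → IncidentAt (upper m) m
      upper-incident 0F =
        solve 1 (λ θ → incident (con (+ 1) :+ θ) (con (+ 8)) (con (+ 0)) (con (+ 8)) θ) refl θ₀
      upper-incident 1F =
        solve 1 (λ θ → incident (:- (con (+ 1) :- θ)) (con (+ 0)) (con (+ 0)) (con (+ 0)) θ) refl θ₀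
      upper-incident 2F =
        solve 1 (λ θ → incident (con (+ 1) :- θ) (con (+ 0)) (con (+ 2) :* θ) (con (+ 4)) θ) refl θ₀
      upper-incident 3F =
        solve 1 (λ θ → incident (:- (con (+ 1) :- θ)) (con (+ 0)) (:- (con (+ 2) :* θ)) (con (+ 4)) θ) refl θ₀
      upper-incident 4F =
        solve 1 (λ θ → incident (:- (con (+ 1) :- θ)) (con (+ 0)) (con (+ 2)) (con (+ 4)) θ) refl θ₀
      upper-incident 5F =
        solve 1 (λ θ → incident (con (+ 1) :- θ) (con (+ 0)) (:- con (+ 2)) (con (+ 4)) θ) refl θ₀

      incidentAt⇒section : ∀ i m → IncidentAt i m → section F f U (line i) (meetPoint m)
      incidentAt⇒section i m = incident⇒section (fixed-gradient i) (fixed-meetAbscissa m) (K-numeral (meetHeight m))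

      meetPoint∈lower : ∀ m → section F f U (line (lower m)) (meetPoint m)
      meetPoint∈lower m = incidentAt⇒section (lower m) m (lower-incident m)

      meetPoint∈upper : ∀ m → section F f U (line (upper m)) (meetPoint m)
      meetPoint∈upper m = incidentAt⇒section (upper m) m (upper-incident m)

      section⇒incidentAt : ∀ i m → section F f U (line i) (meetPoint m) → IncidentAt i m
      section⇒incidentAt i m = section⇒incident (fixed-gradient i) (fixed-meetAbscissa m)

      section-⊈ : ∀ m m′ → ¬ IncidentAt (upper m) m′ → IncidentAt (lower m) m′ →
                  ¬ (section F f U (line (lower m)) ≐ section F f U (line (upper m)))
      section-⊈ m m′ ∉upper ∈lower (lower⊆upper , _) =
        ∉upper (section⇒incidentAt (upper m) m′ (lower⊆upper (incidentAt⇒section (lower m) m′ ∈lower)))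

      height0-misses-8 : ∀ {g} → ¬ Incident g (0 · 1#) 0# (8 · 1#)
      height0-misses-8 {g} eq = *-≉0 8≉0 θ₀≉0 (trans eq
        (solve 2 (λ g θ → con (+ 0) :* (con (+ 0) :+ (g :+ g)) :+ con (+ 0) :* θ := con (+ 0)) refl g θ₀))

      sections-distinct : ∀ m → ¬ (section F f U (line (lower m)) ≐ section F f U (line (upper m)))
      sections-distinct 0F = section-⊈ 0F 2F
        (λ eq → *-≉0 (*-≉0 8≉0 θ₀≉0) 1+θ₀≉0 (begin
          8 · 1# * θ₀ * (1# + θ₀)    ≈⟨ solve 1 (λ θ → con (+ 8) :* θ :* (con (+ 1) :+ θ) :=
            con (+ 2) :* θ :* (con (+ 2) :* θ :+ ((con (+ 1) :+ θ) :+ (con (+ 1) :+ θ)))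
              :+ con (+ 8) :* θ :- con (+ 4) :* θ) refl θ₀ ⟩
          2 · 1# * θ₀ * (2 · 1# * θ₀ + ((1# + θ₀) + (1# + θ₀))) + 8 · 1# * θ₀ - 4 · 1# * θ₀
            ≈⟨ x≈y⇒x-y≈0 (sym eq) ⟩
          0#                         ∎))
        (lower-incident 2F)
      sections-distinct 1F = section-⊈ 1F 2F
        (λ eq → *-≉0 (*-≉0 8≉0 θ₀≉0) 1-θ₀≉0 (begin
          8 · 1# * θ₀ * (1# - θ₀)    ≈⟨ solve 1 (λ θ → con (+ 8) :* θ :* (con (+ 1) :- θ) :=
            con (+ 4) :* θ :- (con (+ 2) :* θ :* (con (+ 2) :* θ :+ (:- (con (+ 1) :- θ) :+ :- (con (+ 1) :- θ)))
              :+ con (+ 0) :* θ)) refl θ₀ ⟩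
          4 · 1# * θ₀ - (2 · 1# * θ₀ * (2 · 1# * θ₀ + (- (1# - θ₀) + - (1# - θ₀))) + 0# * θ₀)  ≈⟨ x≈y⇒x-y≈0 eq ⟩
          0#                         ∎))
        (upper-incident 2F)
      sections-distinct 2F = section-⊈ 2F 0F height0-misses-8 (lower-incident 0F)
      sections-distinct 3F = section-⊈ 3F 0F height0-misses-8 (upper-incident 0F)
      sections-distinct 4F = section-⊈ 4F 0F height0-misses-8 (lower-incident 0F)
      sections-distinct 5F = section-⊈ 5F 0F height0-misses-8 (upper-incident 0F)

      blocks-distinct : ∀ i j → section F f U (line i) ≐ section F f U (line j) → i ≡ j
      blocks-distinct = pairwise-distinct (λ (i⊆j , j⊆i) → j⊆i , i⊆j) sections-distinct

      x≈y⇒multiple≈0 : ∀ {x y z} → z ≈ x - y → x ≈ y → z ≈ 0#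
      x≈y⇒multiple≈0 z≈x-y x≈y = trans z≈x-y (x≈y⇒x-y≈0 x≈y)

      outerAbscissa-injective : ∀ i j → outerAbscissa i ≈ outerAbscissa j → i ≡ j
      outerAbscissa-injective = pairwise-distinct sym apart
        where
        apart : ∀ m → outerAbscissa (lower m) ≉ outerAbscissa (upper m)
        apart 0F = *-≉0 4≉0 θ₀≉0 ∘ x≈y⇒multiple≈0
          (solve 1 (λ θ → con (+ 4) :* θ := con (+ 2) :* θ :- :- (con (+ 2) :* θ)) refl θ₀)
        apart 1F = 4≉0 ∘ x≈y⇒multiple≈0 (solve 0 (con (+ 4) := con (+ 2) :- :- con (+ 2)) refl)
        apart 2F = *-≉0 (-‿≉0 2≉0) 1-θ₀≉0 ∘ x≈y⇒multiple≈0
          (solve 1 (λ θ → :- con (+ 2) :* (con (+ 1) :- θ) := con (+ 2) :* θ :- con (+ 2)) refl θ₀)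
        apart 3F = *-≉0 2≉0 1-θ₀≉0 ∘ x≈y⇒multiple≈0
          (solve 1 (λ θ → con (+ 2) :* (con (+ 1) :- θ) := :- (con (+ 2) :* θ) :- :- con (+ 2)) refl θ₀)
        apart 4F = *-≉0 2≉0 1+θ₀≉0 ∘ x≈y⇒multiple≈0
          (solve 1 (λ θ → con (+ 2) :* (con (+ 1) :+ θ) := con (+ 2) :* θ :- :- con (+ 2)) refl θ₀)
        apart 5F = *-≉0 (-‿≉0 2≉0) 1+θ₀≉0 ∘ x≈y⇒multiple≈0
          (solve 1 (λ θ → :- con (+ 2) :* (con (+ 1) :+ θ) := :- (con (+ 2) :* θ) :- con (+ 2)) refl θ₀)

      height≈ : ∀ m m′ → meetPoint m ≈ₚ meetPoint m′ → meetHeight m · 1# ≈ meetHeight m′ · 1#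
      height≈ m m′ eq = *-cancelʳ θ≉0 (proj₂ (aff-injective eq))

      8≉4 : 8 · 1# ≉ 4 · 1#
      8≉4 = 4≉0 ∘ x≈y⇒multiple≈0 (solve 0 (con (+ 4) := con (+ 8) :- con (+ 4)) refl)

      meetPoint-injective : ∀ m m′ → meetPoint m ≈ₚ meetPoint m′ → m ≡ m′
      meetPoint-injective 0F            0F             eq = ≡.refl
      meetPoint-injective 0F            1F             eq = contradiction (height≈ 0F 1F eq) 8≉0
      meetPoint-injective 0F            m′@(suc (suc _)) eq = contradiction (height≈ 0F m′ eq) 8≉4
      meetPoint-injective 1F            0F             eq = contradiction (sym (height≈ 1F 0F eq)) 8≉0
      meetPoint-injective 1F            1F             eq = ≡.refl
      meetPoint-injective 1F            m′@(suc (suc _)) eq = contradiction (sym (height≈ 1F m′ eq)) 4≉0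
      meetPoint-injective m@(suc (suc _)) 0F           eq = contradiction (sym (height≈ m 0F eq)) 8≉4
      meetPoint-injective m@(suc (suc _)) 1F           eq = contradiction (height≈ m 1F eq) 4≉0
      meetPoint-injective (suc (suc i)) (suc (suc j))  eq =
        ≡.cong (λ l → suc (suc l)) (outerAbscissa-injective i j (*-cancelˡ h≉0 (proj₁ (aff-injective eq))))

      configuration : ONanConfiguration F f U q
      configuration = record
        { line          = line
        ; isBlock       = line-isBlock
        ; blockDistinct = λ i j i≢j eq → i≢j (blocks-distinct i j eq)
        ; meet          = λ i j → meetPoint (pair i j)
        ; meet∈         = λ i j i<j → let l≡i , u≡j = pair-ends i j i<j in
            ≡.subst (λ i′ → section F f U (line i′) (meetPoint (pair i j))) l≡i (meetPoint∈lower (pair i j))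
          , ≡.subst (λ j′ → section F f U (line j′) (meetPoint (pair i j))) u≡j (meetPoint∈upper (pair i j))
        ; meetDistinct  = λ i j k l i<j k<l eq →
            let pair≡ = meetPoint-injective (pair i j) (pair k l) eq
                l≡i , u≡j = pair-ends i j i<j
                l≡k , u≡l = pair-ends k l k<l
            in ≡.trans (≡.sym l≡i) (≡.trans (≡.cong lower pair≡) l≡k)
             , ≡.trans (≡.sym u≡j) (≡.trans (≡.cong upper pair≡) u≡l)
        }

    oNan-configuration : ONanConfiguration F f U q
    oNan-configuration =
      let h , θ₀ , h≉0 , θ₀≉0 , φθ₀≈θ₀ , hφhθ₀≈θ = fixed-decomposition θ≉0
      in configuration h≉0 θ₀≉0 φθ₀≈θ₀ hφhθ₀≈θ

-- Specialisation to finite fields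

open import Data.Nat using (_+_; _*_; _^_; _≤_)

Odd⇒1+2* : ∀ {m} → Odd m → ∃[ j ] m ≡ 1 ℕ.+ j ℕ.* 2
Odd⇒1+2* {m} odd = m ℕ./ 2 , ≡.trans (ℕ.m≡m%n+[m/n]*n m 2) (≡.cong (ℕ._+ m ℕ./ 2 ℕ.* 2) m%2≡1)
  where
  m%2≡1 : m ℕ.% 2 ≡ 1
  m%2≡1 with m ℕ.% 2 in eq | ℕ.m%n<n m 2
  ... | 0           | _ = contradiction (ℕ.m%n≡0⇒n∣m m 2 eq) odd
  ... | 1           | _ = ≡.refl
  ... | suc (suc _) | ℕ.s≤s (ℕ.s≤s ())

module _ (F : CommutativeRing c ℓ) (isField : IsField F) where
  open CommutativeRing F hiding (zero) renaming (_+_ to _+ᶠ_; _*_ to _*ᶠ_)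
  open IsField isField
  open Exp semiring using (^-congˡ; ^-assocʳ) renaming (_^_ to _^ᶠ_)
  open Algebra.Properties.Semiring.Mult semiring using (idem-×-homo-*) renaming (_×_ to _·_)
  open SetoidReasoning setoid

  module _ {m : ℕ} (finite : HasOrder setoid m) where
    open FiniteSetoid {S = setoid} finite using (_≟_)

    fermat : ∀ x → x ^ᶠ m ≈ x
    fermat x = Fermat.fermat F isField _≟_ {K = λ _ → ⊤} total total-hasSize tt
      where
      total : IsSubfield F (λ _ → ⊤)
      total = record
        { resp      = λ _ _ → tt
        ; 0∈        = tt
        ; 1∈        = tt
        ; +-closed  = λ _ _ → tt
        ; -‿closed  = λ _ → tt
        ; *-closed  = λ _ _ → tt
        ; ⁻¹-closed = λ _ _ → tt
        }
      total-hasSize : HasSize setoid (λ _ → ⊤) m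
      total-hasSize = record
        { to        = λ i → Inverse.to finite i , tt
        ; from      = λ (x , _) → Inverse.from finite x
        ; to-cong   = Inverse.to-cong finite
        ; from-cong = Inverse.from-cong finite
        ; inverse   = Inverse.inverseˡ finite , Inverse.inverseʳ finite
        }

    fermat-iterated : ∀ e x → x ^ᶠ (m ^ e) ≈ x
    fermat-iterated zero    x = *-identityʳ x
    fermat-iterated (suc e) x = begin
      x ^ᶠ (m * m ^ e)      ≈⟨ ^-assocʳ x m (m ^ e) ⟨
      (x ^ᶠ m) ^ᶠ (m ^ e)   ≈⟨ ^-congˡ (m ^ e) (fermat x) ⟩
      x ^ᶠ (m ^ e)          ≈⟨ fermat-iterated e x ⟩
      x                     ∎

    -- (p^e) · 1 is a power of p · 1, and a field has no zero divisors; this extracts the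
    -- characteristic from the order of the field.
    p^e·1≈0⇒p·1≈0 : ∀ p e → (p ^ e) · 1# ≈ 0# → p · 1# ≈ 0#
    p^e·1≈0⇒p·1≈0 p zero    1·1≈0 = contradiction (trans (sym (+-identityʳ 1#)) 1·1≈0) 1≉0
    p^e·1≈0⇒p·1≈0 p (suc e) p*p^e·1≈0
      with x*y≈0⇒x≈0∨y≈0 (trans (idem-×-homo-* p (p ^ e) (*-identityˡ 1#)) p*p^e·1≈0)
      where open FieldProperties F isField _≟_ using (x*y≈0⇒x≈0∨y≈0)
    ... | inj₁ p·1≈0   = p·1≈0
    ... | inj₂ p^e·1≈0 = p^e·1≈0⇒p·1≈0 p e p^e·1≈0

    -- K exhausts the roots of X^q - X.
    x^q≈x⇒K : {K : Pred Carrier κ} → IsSubfield F K → ∀ {q} → HasSize setoid K q →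
              ∀ {x} → x ^ᶠ q ≈ x → K x
    x^q≈x⇒K {K = K} isSubfield {q} sizeK {x} x^q≈x = cases q ≡.refl
      where
      open IsSubfield isSubfield
      open FieldProperties F isField _≟_ using (monic; monic-roots; fermatPolynomial; fermatPolynomial-root)
      open FiniteSetoid {S = On.setoid {B = ∃ K} setoid proj₁} sizeK
        using (element; index; index-injective; element-injective)
      -- Together with the q elements of `K`, x makes q + 1 roots of a polynomial of degree q, so
      -- two agree. Distinct indices give distinct elements of `K`, so x is one of them.
      root : Fin (suc q) → Carrier
      root zero    = x
      root (suc i) = proj₁ (element i)
      collision⇒K : (∃[ i ] ∃[ j ] i ≢ j × root i ≈ root j) → K x
      collision⇒K (zero  , zero  , 0≢0 , _)     = contradiction ≡.refl 0≢0
      collision⇒K (zero  , suc j , _   , x≈eⱼ)  = resp (sym x≈eⱼ) (proj₂ (element j))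
      collision⇒K (suc i , zero  , _   , eᵢ≈x)  = resp eᵢ≈x (proj₂ (element i))
      collision⇒K (suc i , suc j , i≢j , eᵢ≈eⱼ) = contradiction (≡.cong suc (element-injective eᵢ≈eⱼ)) i≢j
      root^q≈root : ∀ i → root i ^ᶠ q ≈ root i
      root^q≈root zero    = x^q≈x
      root^q≈root (suc i) = Fermat.fermat F isField _≟_ isSubfield sizeK (proj₂ (element i))
      Fin-1-trivial : ∀ (i j : Fin 1) → i ≡ j
      Fin-1-trivial zero zero = ≡.refl
      -- The polynomial is encoded only for q ≥ 2: 0 ∈ `K` excludes q = 0, and 0 ≠ 1 excludes q = 1.
      cases : ∀ q′ → q ≡ q′ → K x
      cases 0 ≡.refl with () ← index (0# , 0∈)
      cases 1 ≡.refl = contradiction (index-injective {1# , 1∈} {0# , 0∈} (Fin-1-trivial _ _)) 1≉0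
      cases (suc (suc d)) ≡.refl =
        collision⇒K (monic-roots (fermatPolynomial d) root (λ i → fermatPolynomial-root d (root^q≈root i)))

  p·1≈0∧Odd⇒1+1≉0 : ∀ {p} → p · 1# ≈ 0# → Odd p → 1# +ᶠ 1# ≉ 0#
  p·1≈0∧Odd⇒1+1≉0 {p} p·1≈0 odd 1+1≈0 with Odd⇒1+2* odd
  ... | j , ≡.refl = 1≉0 (begin
    1#                           ≈⟨ +-identityʳ 1# ⟨
    1# +ᶠ 0#                     ≈⟨ +-congˡ (zeroʳ (j · 1#)) ⟨
    1# +ᶠ (j · 1#) *ᶠ 0#         ≈⟨ +-congˡ (*-congˡ (trans (+-congˡ (+-identityʳ 1#)) 1+1≈0)) ⟨
    1# +ᶠ (j · 1#) *ᶠ (2 · 1#)   ≈⟨ +-congˡ (idem-×-homo-* j 2 (*-identityˡ 1#)) ⟩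
    1# +ᶠ (j * 2) · 1#           ≈⟨ p·1≈0 ⟩
    0#                           ∎)

  fold-^ : ∀ r x m → fold x (_^ᶠ r) m ≈ x ^ᶠ (r ^ m)
  fold-^ r x zero    = sym (*-identityʳ x)
  fold-^ r x (suc m) = begin
    fold x (_^ᶠ r) m ^ᶠ r      ≈⟨ ^-congˡ r (fold-^ r x m) ⟩
    (x ^ᶠ (r ^ m)) ^ᶠ r        ≈⟨ ^-assocʳ x (r ^ m) r ⟩
    x ^ᶠ (r ^ m * r)           ≡⟨ ≡.cong (x ^ᶠ_) (ℕ.*-comm (r ^ m) r) ⟩
    x ^ᶠ (r ^ suc m)           ∎

-- This makes the iterate of x ↦ x^(p^k) taken 2n/gcd(2n,k) times a power of x ↦ x^(q²), which is
-- the identity by Fermat.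
period : ∀ n k → k * ((2 * n) /gcd k) ≡ ℕ.quotient (gcd[m,n]∣n (2 * n) k) * (2 * n)
period n k = begin
  k * m              ≡⟨ ≡.cong (_* m) (ℕ._∣_.equality (gcd[m,n]∣n (2 * n) k)) ⟩
  k′ * g * m         ≡⟨ ℕ.*-assoc k′ g m ⟩
  k′ * (g * m)       ≡⟨ ≡.cong (k′ *_) (ℕ.*-comm g m) ⟩
  k′ * (m * g)       ≡⟨ ≡.cong (k′ *_) (ℕ._∣_.equality (gcd[m,n]∣m (2 * n) k)) ⟨
  k′ * (2 * n)       ∎
  where
  open ≡.≡-Reasoning
  g  = gcd (2 * n) k
  m  = (2 * n) /gcd k
  k′ = ℕ.quotient (gcd[m,n]∣n (2 * n) k)

theorem3p14 : ∀ {c ℓ κ : Level} (p n k : ℕ) →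
    Prime p → Odd p → 1 ≤ n →
    1 ≤ k → k ≤ n → Odd ((2 * n) /gcd k) →
    let q = p ^ n in
    (F : CommutativeRing c ℓ) →
    let module F = CommutativeRing F
        _^ᶠ_ = Exp._^_ F.semiring in
    IsField F → HasOrder F.setoid (q ^ 2) →
    (K : Pred F.Carrier κ) → IsSubfield F K → HasSize F.setoid K q →
    (f : F.Carrier → F.Carrier) →
    (∀ x → f x F.≈ (x ^ᶠ 2)) ⊎ (∀ x → f x F.≈ (x ^ᶠ (p ^ k + 1))) →
    (θ : F.Carrier) → ¬ (θ F.≈ F.0#) →
    ¬ IsSquareIn F K (θ ^ᶠ (q + 1)) →
    ONanConfiguration F f (𝒰 F K θ) q
theorem3p14 p n k p-prime p-odd _ _ _ m-odd F isField finite K isSubfield sizeK f f≈ θ θ≉0 nonsquare =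
  -- The square is x φ(x) for φ the identity, of period 1, so j = 0.
  [ (λ f≈x² → oNan-configuration (isRingHomomorphism F id (λ _ _ → refl) (λ _ _ → refl) refl) 0 (λ _ → refl)
      (λ x → trans (f≈x² x) (*-congˡ (*-identityʳ x))))
  , (λ f≈x^[p^k+1] → oNan-configuration (frobenius-isRingHomomorphism k) j frobenius-period
      (λ x → trans (f≈x^[p^k+1] x) (trans (x^[m+1]≈x^m*x x (p ^ k)) (*-comm _ _))))
  ]′ f≈
  where
  open CommutativeRing F hiding (zero) renaming (_+_ to _+ᶠ_; _*_ to _*ᶠ_)
  open Exp semiring using (^-homo-*; ^-assocʳ) renaming (_^_ to _^ᶠ_)
  open Algebra.Properties.Semiring.Mult semiring using () renaming (_×_ to _·_)
  open SetoidReasoning setoid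
  q = p ^ n
  j = proj₁ (Odd⇒1+2* m-odd)
  open FiniteSetoid {S = setoid} finite using (_≟_)

  p·1≈0 : p · 1# ≈ 0#
  p·1≈0 = p^e·1≈0⇒p·1≈0 F isField finite p (n * 2)
    (≡.subst (λ r → r · 1# ≈ 0#) (ℕ.^-*-assoc p n 2) (order·1≈0 F finite))

  open PrimeCharacteristic F p-prime p·1≈0 using (frobenius-isRingHomomorphism)

  x^[m+1]≈x^m*x : ∀ x m → x ^ᶠ (m + 1) ≈ x ^ᶠ m *ᶠ x
  x^[m+1]≈x^m*x x m = trans (^-homo-* x m 1) (*-congˡ (*-identityʳ x))

  isInvolution : IsInvolution F K (_^ᶠ q)
  isInvolution = record
    { isEndomorphism = frobenius-isRingHomomorphism n
    ; involutive     = λ x → trans (^-assocʳ x q q)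
        (≡.subst (λ r → x ^ᶠ (q * r) ≈ x) (ℕ.*-identityʳ q) (fermat F isField finite x))
    ; fixed⇒K        = x^q≈x⇒K F isField finite isSubfield sizeK
    ; K⇒fixed        = Fermat.fermat F isField _≟_ isSubfield sizeK
    }

  norm-nonsquare : ¬ IsSquareIn F K (θ *ᶠ θ ^ᶠ q)
  norm-nonsquare (s , s∈K , s²≈) =
    nonsquare (s , s∈K , trans s²≈ (trans (*-comm _ _) (sym (x^[m+1]≈x^m*x θ q))))

  oNan-configuration : ∀ {φ} → IsEndomorphism F φ → ∀ j → HasPeriod F φ (1 + j * 2) →
                       (∀ x → f x ≈ x *ᶠ φ x) → ONanConfiguration F f (𝒰 F K θ) q
  oNan-configuration isEndomorphism j φ-period f≈xφx =
    Configuration.oNan-configuration F isField finite (p·1≈0∧Odd⇒1+1≉0 F isField p·1≈0 p-odd) isSubfield sizeK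
      isInvolution isEndomorphism j φ-period f≈xφx θ≉0 norm-nonsquare

  frobenius-period : HasPeriod F (_^ᶠ (p ^ k)) (1 + j * 2)
  frobenius-period x = begin
    fold x (_^ᶠ (p ^ k)) (1 + j * 2)     ≡⟨ ≡.cong (fold x (_^ᶠ (p ^ k))) (proj₂ (Odd⇒1+2* m-odd)) ⟨
    fold x (_^ᶠ (p ^ k)) m               ≈⟨ fold-^ F isField (p ^ k) x m ⟩
    x ^ᶠ ((p ^ k) ^ m)                   ≡⟨ ≡.cong (x ^ᶠ_) exponent ⟩
    x ^ᶠ ((q ^ 2) ^ k′)                  ≈⟨ fermat-iterated F isField finite k′ x ⟩
    x                                    ∎
    where
    m  = (2 * n) /gcd k
    k′ = ℕ.quotient (gcd[m,n]∣n (2 * n) k)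
    exponent : (p ^ k) ^ m ≡ (q ^ 2) ^ k′
    exponent = ≡.trans (ℕ.^-*-assoc p k m) (≡.trans (≡.cong (p ^_) (≡.trans (period n k) (ℕ.*-comm k′ (2 * n))))
      (≡.trans (≡.sym (ℕ.^-*-assoc p (2 * n) k′))
        (≡.cong (_^ k′) (≡.trans (≡.cong (p ^_) (ℕ.*-comm 2 n)) (≡.sym (ℕ.^-*-assoc p n 2))))))
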